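{- There exists an absolute constant $C>0$ such that for every non-empty graph $G$ (i.e. a graph with at least one edge) and every connected graph $H$, writing $k=\max(|G|,|H|)$, we have for every integer $n\ge 2^{Ck}$ $$r(G,nH)=n|H|+r(\mathcal{D}(G),H)-1.$$
   Context: All graphs are finite and simple; $|G|$ denotes the number of vertices of $G$. $nH$ denotes the graph consisting of $n$ vertex-disjoint copies of $H$. For two families of graphs $\mathcal{G},\mathcal{H}$, $r(\mathcal{G},\mathcal{H})$ is the smallest integer $N$ such that every colouring of the edges of the complete graph on $N$ vertices with two colours contains a copy (as a not necessarily induced subgraph) of some graph from $\mathcal{G}$ in the first colour or a copy of some graph from $\mathcal{H}$ in the second colour. A single graph in place of a family stands for the family consisting of that graph only. $\mathcal{D}(G)$ is the family of graphs obtained from $G$ by deleting (all vertices of) an inclusion-maximal independent set of $G$. -}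

module Defs where

open import Data.Fin using (Fin; remQuot)
open import Data.Fin.Properties using (_≟_)
open import Data.Fin.Subset using (Subset; _∈_; _⊆_)
open import Data.Fin.Subset.Properties using (_∈?_)
open import Data.List using (List; length; lookup; filter; allFin)
open import Data.Nat using (ℕ; _*_; _≤_; _>_)
open import Data.Product using (_×_; _,_; proj₁; proj₂; ∃₂; ∃-syntax)
open import Data.Sum using (_⊎_)
open import Function using (_on_)
open import Function.Definitions using (Injective)
open import Level using (0ℓ) renaming (suc to lsuc)
open import Relation.Binary using (Rel; Symmetric; Irreflexive; Decidable; DecidableEquality)
open import Relation.Binary.Construct.Closure.ReflexiveTransitive using (Star)
open import Relation.Binary.PropositionalEquality using (_≡_; _≢_; refl; sym; trans; ≢-sym)
open import Relation.Nullary using (¬_; yes; no; ¬?; _×-dec_)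
open import Relation.Unary using (Pred)

-- Decidability of adjacency is no restriction classically; it is what makes
-- these finite graphs in the usual sense constructively.
record Graph : Set₁ where
  field
    order      : ℕ
    Adj        : Rel (Fin order) 0ℓ
    Adj-sym    : Symmetric Adj
    Adj-irrefl : Irreflexive _≡_ Adj
    Adj?       : Decidable Adj

  Vertex : Set
  Vertex = Fin order

open Graph

Family : Set₂
Family = Pred Graph (lsuc 0ℓ)

NonEmpty : Graph → Set
NonEmpty G = ∃₂ λ u v → Adj G u v

-- The graph without vertices is not connected.
Connected : Graph → Set
Connected G = order G > 0 × (∀ u v → Star (Adj G) u v)

-- remQuot splits a vertex of n · H into the index of its copy and a vertex of H.
_·_ : ℕ → Graph → Graph
n · H = record
  { order      = n * order H
  ; Adj        = _~_ on split
  ; Adj-sym    = λ (p , q) → sym p , Adj-sym H q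
  ; Adj-irrefl = λ { refl (_ , q) → Adj-irrefl H refl q }
  ; Adj?       = λ x y → (proj₁ (split x) ≟ proj₁ (split y))
                   ×-dec Adj? H (proj₂ (split x)) (proj₂ (split y))
  }
  where
  split : Fin (n * order H) → Fin n × Vertex H
  split = remQuot (order H)

  _~_ : Rel (Fin n × Vertex H) 0ℓ
  (i , u) ~ (j , v) = i ≡ j × Adj H u v

-- Containment as a not necessarily induced subgraph.
_⊑_ : Graph → Graph → Set
G ⊑ K = ∃[ f ] Injective _≡_ _≡_ f × (∀ {u v} → Adj G u v → Adj K (f u) (f v))

Independent : (G : Graph) → Subset (order G) → Set
Independent G S = ∀ {u v} → u ∈ S → v ∈ S → ¬ Adj G u v

MaximalIndependent : (G : Graph) → Subset (order G) → Set
MaximalIndependent G S =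
  Independent G S × (∀ {T} → Independent G T → S ⊆ T → T ⊆ S)

-- Vertex i of G ─ S is the i-th vertex of G outside S, in increasing order.
_─_ : (G : Graph) → Subset (order G) → Graph
G ─ S = record
  { order      = length remaining
  ; Adj        = Adj G on lookup remaining
  ; Adj-sym    = Adj-sym G
  ; Adj-irrefl = λ { refl → Adj-irrefl G refl }
  ; Adj?       = λ i j → Adj? G (lookup remaining i) (lookup remaining j)
  }
  where
  remaining : List (Vertex G)
  remaining = filter (λ v → ¬? (v ∈? S)) (allFin (order G))

data 𝒟 (G : Graph) : Family where
  delete : ∀ {S} → MaximalIndependent G S → 𝒟 G (G ─ S)

data Colour : Set where
  first second : Colour

_≟ᶜ_ : DecidableEquality Colour
first  ≟ᶜ first  = yes refl
first  ≟ᶜ second = no λ ()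
second ≟ᶜ first  = no λ ()
second ≟ᶜ second = yes refl

-- Only the values at distinct vertices, i.e. on edges of the complete graph,
-- are ever used: see colourClass.
record Colouring (N : ℕ) : Set where
  field
    colour     : Fin N → Fin N → Colour
    colour-sym : ∀ u v → colour u v ≡ colour v u

open Colouring

colourClass : ∀ {N} → Colouring N → Colour → Graph
colourClass {N} χ c = record
  { order      = N
  ; Adj        = λ u v → u ≢ v × colour χ u v ≡ c
  ; Adj-sym    = λ {u} {v} (u≢v , p) → ≢-sym u≢v , trans (colour-sym χ v u) p
  ; Adj-irrefl = λ u≡v (u≢v , _) → u≢v u≡v
  ; Adj?       = λ u v → ¬? (u ≟ v) ×-dec (colour χ u v ≟ᶜ c)
  }

Arrows : ℕ → Family → Family → Set₁
Arrows N 𝒢 ℋ = (χ : Colouring N) →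
    (∃[ G ] 𝒢 G × G ⊑ colourClass χ first)
  ⊎ (∃[ H ] ℋ H × H ⊑ colourClass χ second)

-- IsRamsey 𝒢 ℋ N says that r(𝒢, ℋ) = N.
IsRamsey : Family → Family → ℕ → Set₁
IsRamsey 𝒢 ℋ N = Arrows N 𝒢 ℋ × (∀ M → Arrows M 𝒢 ℋ → N ≤ M)

{-# OPTIONS --safe #-}
-- Lower bound: join a second-coloured clique on n|H| − 1 vertices by first-coloured edges to an
-- extremal colouring for (𝒟 G, H).
--
-- Upper bound: if there is no first-coloured G then, by the Erdős–Szemerédi argument, some set U of
-- at least 64⁻ᵏ of all vertices has first-colour degrees at most |U| / 64.  Half of U is cut into
-- second-coloured cliques ("blocks") with 2|H| vertices, the rest is a reservoir R.  The vertices
-- outside U with few second-coloured neighbours in R contain no first-coloured member of 𝒟 G, so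
-- copies of H exhaust all but r(𝒟 G, H) − 1 of them.  The other vertices are covered greedily, the
-- leftovers using second-coloured neighbours in R, and R greedily too; what remains are fewer than
-- 8ᵏ vertices of U.  A vertex with |H| − 1 second-coloured neighbours in a block can replace any
-- vertex of that block, and most pairs (vertex of U, block) are of this kind.  By two such
-- replacements each, |H| leftovers are exchanged for vertices of blocks that form a copy of H.
-- Repeating this leaves fewer than |H| leftovers.
module Submission where

import Algebra.Solver.CommutativeMonoid as CommutativeMonoidSolver
open import Data.Bool using (Bool; true; false) renaming (_≟_ to _≟ᵇ_)
open import Data.Empty using (⊥-elim)
open import Data.Fin using (Fin; zero; suc; fromℕ<; inject≤; combine; remQuot; splitAt; join; finToFun; funToFin)
import Data.Fin.Properties as Fin
open import Data.Fin.Subset using (Subset; ∣_∣) renaming (_∈_ to _∈ₛ_; _∉_ to _∉ₛ_; _⊆_ to _⊆ₛ_; ⊥ to ∅)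
import Data.Fin.Subset.Properties as Subset
open import Data.List using (List; []; _∷_; [_]; _++_; length; map; filter; concat; take; drop; lookup; tabulate; allFin)
import Data.List.Properties as List
open import Data.List.Membership.Propositional using (_∈_; find)
import Data.List.Membership.Propositional.Properties as ∈
open import Data.List.Relation.Binary.Permutation.Propositional using (_↭_; ↭-refl; ↭-sym; ↭-trans; ↭-reflexive; prep; module PermutationReasoning)
open import Data.List.Relation.Binary.Permutation.Propositional.Properties using (↭-length; All-resp-↭; ∈-resp-↭; ++⁺; ++⁺ˡ; ++⁺ʳ; shift; ++-comm; filter-↭; ++-commutativeMonoid)
open import Data.List.Relation.Unary.All as All using (All; []; _∷_; all?)
import Data.List.Relation.Unary.All.Properties as All
open import Data.List.Relation.Unary.AllPairs as AllPairs using (AllPairs; []; _∷_)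
import Data.List.Relation.Unary.AllPairs.Properties as AllPairs
open import Data.List.Relation.Unary.Any as Any using (Any; here; there)
import Data.List.Relation.Unary.Any.Properties as Any
open import Data.List.Relation.Unary.Unique.Propositional using (Unique)
import Data.List.Relation.Unary.Unique.Propositional.Properties as Unique
open import Data.Nat
open import Data.Nat.DivMod using (m/n*n≤m; /-monoˡ-≤; m*n/n≡m)
open import Data.Nat.Induction using (<-wellFounded)
open import Data.Nat.ListAction using (sum)
open import Data.Nat.Properties
open import Data.Nat.Tactic.RingSolver using (solve-∀)
open import Data.Product using (_×_; _,_; proj₁; proj₂; ∃; ∃₂; ∃-syntax; uncurry)
open import Data.Sum as Sum using (_⊎_; inj₁; inj₂; [_,_]′)
open import Data.Unit using (tt) renaming (⊤ to Unit)
import Data.Vec as Vec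
import Data.Vec.Properties as Vec
open import Function using (_∘_; id; case_of_)
open import Function.Definitions using (Injective)
open import Induction.WellFounded using (Acc; acc)
open import Relation.Binary.Construct.Closure.ReflexiveTransitive as Star using (Star)
open import Relation.Binary.PropositionalEquality using (_≡_; _≢_; refl; sym; trans; cong; cong₂; subst; subst₂; ≢-sym)
open import Relation.Nullary using (¬_; Dec; yes; no; ¬?; contradiction; _×-dec_; _⊎-dec_; _→-dec_)
open import Relation.Nullary.Decidable using (map′; decidable-stable)
open import Relation.Unary using (Decidable; ｛_｝)
open import Relation.Unary.Properties using (∁?)
open import Defs

-- Splitting and counting in lists up to permutation.

module _ {A : Set} where

  Part : (List A → Set) → List A → Set
  Part Q xs = ∃₂ λ ys zs → xs ↭ ys ++ zs × Q ys

  Part-⊆ : ∀ {Q xs us vs} → xs ↭ us ++ vs → Part Q us → Part Q xs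
  Part-⊆ {vs = vs} p (ys , zs , q , Qys) =
    ys , zs ++ vs , ↭-trans p (↭-trans (++⁺ʳ vs q) (↭-reflexive (List.++-assoc ys zs vs))) , Qys

  ↭-pick : ∀ {x : A} {xs} → x ∈ xs → ∃ λ ys → xs ↭ x ∷ ys
  ↭-pick x∈xs with ys , zs , refl ← ∈.∈-∃++ x∈xs = ys ++ zs , shift _ ys zs

  ↭-length-++ : ∀ {xs : List A} ys {zs} → xs ↭ ys ++ zs → length xs ≡ length ys + length zs
  ↭-length-++ ys p = trans (↭-length p) (List.length-++ ys)

  All-↭-++ : ∀ {P : A → Set} {xs} ys {zs} → xs ↭ ys ++ zs → All P xs → All P ys × All P zs
  All-↭-++ ys p Pxs = All.++⁻ ys (All-resp-↭ p Pxs)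

  AllPairs-↭ : ∀ {R : A → A → Set} → (∀ {x y} → R x y → R y x) →
    ∀ {xs ys} → xs ↭ ys → AllPairs R xs → AllPairs R ys
  AllPairs-↭ R-sym _↭_.refl rs = rs
  AllPairs-↭ R-sym (_↭_.prep x p) (r ∷ rs) = All-resp-↭ p r ∷ AllPairs-↭ R-sym p rs
  AllPairs-↭ R-sym (_↭_.swap x y p) ((rxy ∷ rx) ∷ ry ∷ rs) =
    (R-sym rxy ∷ All-resp-↭ p ry) ∷ All-resp-↭ p rx ∷ AllPairs-↭ R-sym p rs
  AllPairs-↭ R-sym (_↭_.trans p q) rs = AllPairs-↭ R-sym q (AllPairs-↭ R-sym p rs)

  AllPairs-++⁻ : ∀ {R : A → A → Set} xs {ys} → AllPairs R (xs ++ ys) →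
    AllPairs R xs × AllPairs R ys × All (λ x → All (R x) ys) xs
  AllPairs-++⁻ []       rs       = [] , rs , []
  AllPairs-++⁻ (x ∷ xs) (r ∷ rs) with rxs , rys , rxy ← AllPairs-++⁻ xs rs =
    All.++⁻ˡ xs r ∷ rxs , rys , All.++⁻ʳ xs r ∷ rxy

  Unique-resp-Part : ∀ {xs : List A} ys {zs} → xs ↭ ys ++ zs → Unique xs →
    Unique ys × Unique zs × All (λ y → All (y ≢_) zs) ys
  Unique-resp-Part ys p u = AllPairs-++⁻ ys (AllPairs-↭ ≢-sym p u)

  abstract
    -- The positive length `suc s` makes the repeated removal terminate; `Φ` is an invariant of the
    -- rest that `find` may rely on.
    greedy : ∀ (Φ : List A → Set) → (∀ {xs} ys {zs} → xs ↭ ys ++ zs → Φ xs → Φ zs) →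
      ∀ m s {Q : List A → Set} →
      (∀ xs → Φ xs → m ≤ length xs → Part (λ ys → length ys ≡ suc s × Q ys) xs) →
      ∀ xs → Φ xs →
      ∃₂ λ bs zs → xs ↭ concat bs ++ zs × All (λ b → length b ≡ suc s × Q b) bs × length zs < m × Φ zs
    greedy Φ Φ-rest m s {Q} find xs φ = go xs φ (<-wellFounded (length xs))
      where
      go : ∀ xs → Φ xs → Acc _<_ (length xs) →
        ∃₂ λ bs zs → xs ↭ concat bs ++ zs × All (λ b → length b ≡ suc s × Q b) bs × length zs < m × Φ zs
      go xs φ (acc rec) with m ≤? length xs
      ... | no m≰ = [] , xs , ↭-refl , [] , ≰⇒> m≰ , φ
      ... | yes m≤ with ys , zs , p , ∣ys∣ , Qys ← find xs φ m≤
        with bs , ws , q , Qbs , ws< , φws ← go zs (Φ-rest ys p φ)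
               (rec (subst (λ l → length zs < l) (sym (trans (↭-length-++ ys p) (cong (_+ length zs) ∣ys∣))) (s≤s (m≤n+m _ s))))
        = ys ∷ bs , ws , ↭-trans p (↭-trans (++⁺ˡ ys q) (↭-reflexive (sym (List.++-assoc ys (concat bs) ws)))) ,
          (∣ys∣ , Qys) ∷ Qbs , ws< , φws

  greedy′ : ∀ m s {Q : List A → Set} →
    (∀ xs → m ≤ length xs → Part (λ ys → length ys ≡ suc s × Q ys) xs) →
    ∀ xs → ∃₂ λ bs zs → xs ↭ concat bs ++ zs × All (λ b → length b ≡ suc s × Q b) bs × length zs < m
  greedy′ m s find xs
    with bs , zs , p , Qbs , zs< , _ ← greedy (λ _ → Unit) (λ _ _ _ → tt) m s (λ xs _ → find xs) xs tt
    = bs , zs , p , Qbs , zs<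

  count : ∀ {P : A → Set} → Decidable P → List A → ℕ
  count P? xs = length (filter P? xs)

  module _ {P : A → Set} (P? : Decidable P) where

    filter-split : ∀ xs → xs ↭ filter P? xs ++ filter (∁? P?) xs
    filter-split []       = ↭-refl
    filter-split (x ∷ xs) with P? x
    ... | yes _ = prep x (filter-split xs)
    ... | no  _ = ↭-trans (prep x (filter-split xs)) (↭-sym (shift x (filter P? xs) (filter (∁? P?) xs)))

    Part-filter : ∀ {Q xs} → Part Q (filter P? xs) → Part (λ ys → Q ys × All P ys) xs
    Part-filter {Q} {xs} (ys , zs , p , Qys) =
      Part-⊆ (filter-split xs) (ys , zs , p , Qys , proj₁ (All-↭-++ ys p (All.all-filter P? xs)))

    count-++ : ∀ xs ys → count P? (xs ++ ys) ≡ count P? xs + count P? ys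
    count-++ xs ys = trans (cong length (List.filter-++ P? xs ys)) (List.length-++ (filter P? xs))

    count-↭-++ : ∀ {xs} ys {zs} → xs ↭ ys ++ zs → count P? xs ≡ count P? ys + count P? zs
    count-↭-++ ys {zs} p = trans (↭-length (filter-↭ P? p)) (count-++ ys zs)

    count-∁ : ∀ xs → length xs ≡ count P? xs + count (∁? P?) xs
    count-∁ xs = ↭-length-++ (filter P? xs) (filter-split xs)

    count-mono-↭ : ∀ {xs} ys {zs} → xs ↭ ys ++ zs → count P? zs ≤ count P? xs
    count-mono-↭ ys p = subst (_ ≤_) (sym (count-↭-++ ys p)) (m≤n+m _ _)

    count<⇒∁ : ∀ xs → count P? xs < length xs → ∃ λ x → x ∈ xs × ¬ P x
    count<⇒∁ (x ∷ xs) lt with P? x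
    ... | no ¬Px = x , here refl , ¬Px
    ... | yes _ with y , y∈ , ¬Py ← count<⇒∁ xs (≤-pred lt) = y , there y∈ , ¬Py

-- Ramsey's theorem for two colours and sparse vertex sets.

module Ramsey {X : Set} (col : X → X → Colour) where

  Clique : Colour → List X → Set
  Clique c = AllPairs (λ u v → col u v ≡ c)

  side : Colour → X → List X → List X
  side c v = filter (λ w → col v w ≟ᶜ c)

  side-split : ∀ v xs → xs ↭ side first v xs ++ side second v xs
  side-split v []       = ↭-refl
  side-split v (x ∷ xs) with col v x
  ... | first  = prep x (side-split v xs)
  ... | second = ↭-trans (prep x (side-split v xs)) (↭-sym (shift x (side first v xs) (side second v xs)))

  side-split′ : ∀ c v xs → ∃ λ zs → xs ↭ side c v xs ++ zs
  side-split′ first  v xs = _ , side-split v xs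
  side-split′ second v xs = _ , ↭-trans (side-split v xs) (++-comm (side first v xs) (side second v xs))

  side-split-∷ : ∀ c v xs → v ∷ xs ↭ side c v xs ++ v ∷ proj₁ (side-split′ c v xs)
  side-split-∷ c v xs with zs , p ← side-split′ c v xs = ↭-trans (prep v p) (↭-sym (shift v (side c v xs) zs))

  extend : ∀ {c} l v xs → Part (λ ys → length ys ≡ l × Clique c ys) (side c v xs) →
    Part (λ ys → length ys ≡ suc l × Clique c ys) (v ∷ xs)
  extend {c} l v xs (ys , zs , p , ∣ys∣ , cl) with ws , q ← side-split′ c v xs =
    v ∷ ys , zs ++ ws , prep v (↭-trans q (↭-trans (++⁺ʳ ws p) (↭-reflexive (List.++-assoc ys zs ws)))) ,
    cong suc ∣ys∣ , proj₁ (All-↭-++ ys p (All.all-filter (λ w → col v w ≟ᶜ c) xs)) ∷ cl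

  -- Induction on `a + b`: by pigeonhole one of the two colour neighbourhoods of the first vertex
  -- keeps half of the required number, which suffices after lowering `a` or `b` by one.
  ramsey : ∀ a b xs → 2 ^ (a + b) ≤ length xs →
    Part (λ ys → length ys ≡ a × Clique first ys) xs ⊎ Part (λ ys → length ys ≡ b × Clique second ys) xs
  ramsey zero    b       xs _ = inj₁ ([] , xs , ↭-refl , refl , [])
  ramsey (suc a) zero    xs _ = inj₂ ([] , xs , ↭-refl , refl , [])
  ramsey (suc a) (suc b) []       big = contradiction big (<⇒≱ (m^n>0 2 (suc a + suc b)))
  ramsey (suc a) (suc b) (x ∷ xs) big with 2 ^ (a + suc b) ≤? length (side first x xs)
  ... | yes le = [ inj₁ ∘ extend a x xs , inj₂ ∘ Part-⊆ (side-split-∷ first x xs) ]′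
                   (ramsey a (suc b) (side first x xs) le)
  ... | no ≰ = [ inj₁ ∘ Part-⊆ (side-split-∷ second x xs) , inj₂ ∘ extend b x xs ]′
                 (ramsey (suc a) b (side second x xs) le)
    where
    p = 2 ^ (a + suc b)
    r = length (side first x xs)
    s = length (side second x xs)
    open ≤-Reasoning
    le : 2 ^ suc (a + b) ≤ s
    -- The vertex `x` itself, counted by the `suc`, is paid for by the strict inequality `r < p`.
    le = +-cancelˡ-≤ p _ _ (begin
      p + 2 ^ suc (a + b)   ≡⟨ cong (λ e → p + 2 ^ e) (+-suc a b) ⟨
      p + p                 ≡⟨ cong (p +_) (+-identityʳ p) ⟨
      2 ^ (suc a + suc b)   ≤⟨ big ⟩
      suc (length xs)       ≡⟨ cong suc (↭-length-++ (side first x xs) (side-split x xs)) ⟩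
      suc r + s             ≤⟨ +-monoˡ-≤ s (≰⇒> ≰) ⟩
      p + s                 ∎)

  -- The Erdős–Szemerédi argument: as long as some vertex has many first-coloured
  -- neighbours, pass to these neighbours.
  sparse : (∀ v → col v v ≡ second) → ∀ q .{{_ : NonZero q}} l xs →
    Part (λ ys → length ys ≡ l × Clique first ys) xs ⊎
    Part (λ us → length xs ≤ q ^ l * length us × All (λ v → q * length (side first v us) ≤ length us) us) xs
  sparse diag q zero xs = inj₁ ([] , xs , ↭-refl , refl , [])
  sparse diag q (suc l) xs with all? (λ v → q * length (side first v xs) ≤? length xs) xs
  ... | yes few = inj₂ (xs , [] , ↭-reflexive (sym (List.++-identityʳ xs)) ,
                        m≤n*m (length xs) (q ^ suc l) {{m^n≢0 q (suc l)}} , few)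
  ... | no ¬few
    with v , v∈xs , many ← find (All.¬All⇒Any¬ (λ v → q * length (side first v xs) ≤? length xs) xs ¬few)
    with sparse diag q l (side first v xs)
  ... | inj₁ (ys , zs , p , ∣ys∣ , cl) =
    -- As the loop at `v` has the second colour, `v` is found in the second-coloured side, away from
    -- `ys`.
    let ws , r = ↭-pick (∈.∈-filter⁺ (λ w → col v w ≟ᶜ second) v∈xs (diag v)) in
    inj₁ (v ∷ ys , zs ++ ws ,
      (begin
        xs                                          ↭⟨ side-split v xs ⟩
        side first v xs ++ side second v xs         ↭⟨ ++⁺ p r ⟩
        (ys ++ zs) ++ v ∷ ws                        ↭⟨ shift v (ys ++ zs) ws ⟩
        v ∷ (ys ++ zs) ++ ws                        ≡⟨ cong (v ∷_) (List.++-assoc ys zs ws) ⟩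
        v ∷ ys ++ zs ++ ws                          ∎) ,
      cong suc ∣ys∣ , proj₁ (All-↭-++ ys p (All.all-filter (λ w → col v w ≟ᶜ first) xs)) ∷ cl)
    where open PermutationReasoning
  ... | inj₂ (us , zs , p , big , few) = inj₂ (Part-⊆ (side-split v xs) (us , zs , p , (begin
        length xs                       ≤⟨ <⇒≤ (≰⇒> many) ⟩
        q * length (side first v xs)    ≤⟨ *-monoʳ-≤ q big ⟩
        q * (q ^ l * length us)         ≡⟨ *-assoc q (q ^ l) (length us) ⟨
        q ^ suc l * length us           ∎) , few))
    where open ≤-Reasoning

-- Arithmetic for the block construction.

abstract

  +-swap : ∀ a b c → a + (b + c) ≡ b + (a + c)
  +-swap = solve-∀

  half : ∀ {p good bad m} → p ≡ good + bad → 2 * bad ≤ p → 2 * m ≤ p → m ≤ good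
  half {p} {good} {bad} {m} refl bad≤ m≤ = *-cancelˡ-≤ 2 (+-cancelʳ-≤ p (2 * m) (2 * good) (begin
    2 * m + p              ≤⟨ +-monoˡ-≤ p m≤ ⟩
    p + p                  ≡⟨ lemma good bad ⟩
    2 * good + 2 * bad     ≤⟨ +-monoʳ-≤ (2 * good) bad≤ ⟩
    2 * good + p           ∎))
    where
    open ≤-Reasoning
    lemma : ∀ a b → (a + b) + (a + b) ≡ 2 * a + 2 * b
    lemma = solve-∀

  ⌊n/2⌋*2≤ : ∀ n → 2 * ⌊ n /2⌋ ≤ n
  ⌊n/2⌋*2≤ zero          = z≤n
  ⌊n/2⌋*2≤ (suc zero)    = z≤n
  ⌊n/2⌋*2≤ (suc (suc n)) = subst (_≤ suc (suc n)) (sym (*-suc 2 ⌊ n /2⌋)) (s≤s (s≤s (⌊n/2⌋*2≤ n)))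

  ≤⌊n/2⌋*2 : ∀ n → n ≤ suc (2 * ⌊ n /2⌋)
  ≤⌊n/2⌋*2 zero          = z≤n
  ≤⌊n/2⌋*2 (suc zero)    = s≤s z≤n
  ≤⌊n/2⌋*2 (suc (suc n)) = subst (suc (suc n) ≤_) (cong suc (sym (*-suc 2 ⌊ n /2⌋))) (s≤s (s≤s (≤⌊n/2⌋*2 n)))

  half≤ : ∀ a {b u} → 2 * a ≤ u → u ≤ a + b → u ≤ 2 * b
  half≤ a {b} {u} a≤ u≤ = +-cancelˡ-≤ u u (2 * b) (begin
    u + u              ≤⟨ +-mono-≤ u≤ u≤ ⟩
    (a + b) + (a + b)  ≡⟨ lemma a b ⟩
    2 * a + 2 * b      ≤⟨ +-monoˡ-≤ (2 * b) a≤ ⟩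
    u + 2 * b          ∎)
    where
    open ≤-Reasoning
    lemma : ∀ a b → (a + b) + (a + b) ≡ 2 * a + 2 * b
    lemma = solve-∀

  -- `suc (s + suc s)` is the size 2|H| of a block, and `z` counts the vertices of the halved set
  -- that no block takes.
  half-blocks≤ : ∀ {s m u z M} → ⌊ u /2⌋ ≡ m * suc (s + suc s) + z → z < M → u ≤ 4 * suc s * m + 2 * M
  half-blocks≤ {s} {m} {u} {z} {M} eq z< = begin
    u                                    ≤⟨ ≤⌊n/2⌋*2 u ⟩
    suc (2 * ⌊ u /2⌋)                    ≡⟨ cong (λ a → suc (2 * a)) eq ⟩
    suc (2 * (m * suc (s + suc s) + z))  ≤⟨ n≤1+n _ ⟩
    suc (suc (2 * (m * suc (s + suc s) + z)))  ≡⟨ lemma s m z ⟩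
    4 * suc s * m + 2 * suc z            ≤⟨ +-monoʳ-≤ (4 * suc s * m) (*-monoʳ-≤ 2 z<) ⟩
    4 * suc s * m + 2 * M                ∎
    where
    open ≤-Reasoning
    lemma : ∀ s m z → suc (suc (2 * (m * suc (s + suc s) + z))) ≡ 4 * suc s * m + 2 * suc z
    lemma = solve-∀

  blocks≥ : ∀ {s m u M} → 4 * suc s * (8 * M + 4 * suc s) + 2 * M ≤ u → u ≤ 4 * suc s * m + 2 * M →
    8 * M + 4 * suc s ≤ m
  blocks≥ {s} {m} {u} {M} lo hi = *-cancelˡ-≤ (4 * suc s) (+-cancelʳ-≤ (2 * M) _ _ (≤-trans lo hi))

  -- Here `n` blocks not attached to a vertex account for `n * suc s` first-coloured neighbours, at
  -- most a 64th of `u`. Since `u ≤ 6 * suc s * m`, this gives `64 * n ≤ 6 * m`, and 64 is at least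
  -- 36.
  non≤sixth : ∀ {s m u n f M} → n * suc s ≤ f → 64 * f ≤ u → u ≤ 4 * suc s * m + 2 * M →
    8 * M + 4 * suc s ≤ m → n ≤ m / 6
  non≤sixth {s} {m} {u} {n} {f} {M} n≤ f≤ u≤ m≥ = subst (_≤ m / 6) (m*n/n≡m n 6) (/-monoˡ-≤ {m = n * 6} {n = m} 6
    (*-cancelˡ-≤ 6 (≤-trans (≤-trans (≤-reflexive (lemma₁ n)) (m≤n+m (n * 36) (n * 28)))
      (≤-trans (≤-reflexive (lemma₂ n)) (*-cancelˡ-≤ (suc s) (begin
        suc s * (64 * n)           ≡⟨ lemma₃ s n ⟩
        64 * (n * suc s)           ≤⟨ *-monoʳ-≤ 64 n≤ ⟩
        64 * f                     ≤⟨ f≤ ⟩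
        u                          ≤⟨ u≤ ⟩
        4 * suc s * m + 2 * M      ≤⟨ +-monoʳ-≤ (4 * suc s * m) (*-monoʳ-≤ 2 M≤) ⟩
        4 * suc s * m + 2 * (suc s * m)  ≡⟨ lemma₄ s m ⟩
        suc s * (6 * m)            ∎))))))
    where
    open ≤-Reasoning
    M≤ : M ≤ suc s * m
    M≤ = ≤-trans (≤-trans (m≤n*m M 8) (m≤m+n (8 * M) (4 * suc s))) (≤-trans m≥ (m≤n*m m (suc s)))
    lemma₁ : ∀ n → 6 * (n * 6) ≡ n * 36
    lemma₁ = solve-∀
    lemma₂ : ∀ n → n * 28 + n * 36 ≡ 64 * n
    lemma₂ = solve-∀
    lemma₃ : ∀ s n → suc s * (64 * n) ≡ 64 * (n * suc s)
    lemma₃ = solve-∀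
    lemma₄ : ∀ s m → 4 * suc s * m + 2 * (suc s * m) ≡ suc s * (6 * m)
    lemma₄ = solve-∀

  -- Three times `m / 6` costs at most half of `m`; the other half pays for `4 * M + 2 * h`.
  sixths≤ : ∀ {M h m} → 8 * M + 4 * h ≤ m → 2 * M + (2 * M + (m / 6 + 2 * (m / 6) + 2 * h)) ≤ m
  sixths≤ {M} {h} {m} m≥ = *-cancelˡ-≤ 2 (begin
    2 * (2 * M + (2 * M + (m / 6 + 2 * (m / 6) + 2 * h)))  ≡⟨ lemma₁ M h (m / 6) ⟩
    (8 * M + 4 * h) + m / 6 * 6                            ≤⟨ +-mono-≤ m≥ (m/n*n≤m m 6) ⟩
    m + m                                                  ≡⟨ lemma₂ m ⟩
    2 * m                                                  ∎)
    where
    open ≤-Reasoning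
    lemma₁ : ∀ M h b → 2 * (2 * M + (2 * M + (b + 2 * b + 2 * h))) ≡ (8 * M + 4 * h) + b * 6
    lemma₁ = solve-∀
    lemma₂ : ∀ m → m + m ≡ 2 * m
    lemma₂ = solve-∀

  -- Pigeonhole in the form used by `link`: `b` items fail one condition, `d` the other, and
  -- together they do not exhaust all `p`.
  remainder : ∀ {p a b c d e} → p ≡ a + b → b ≤ c → d ≤ e → c + e < p → d < a
  remainder {a = a} {b} {c} {d} {e} refl b≤ d≤ lt = ≤-<-trans d≤ (+-cancelˡ-< c e a (begin-strict
    c + e  <⟨ lt ⟩
    a + b  ≤⟨ +-monoʳ-≤ a b≤ ⟩
    a + c  ≡⟨ +-comm a c ⟩
    c + a  ∎))
    where open ≤-Reasoning

-- Double counting and averaging.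

module _ {A B : Set} {R : A → B → Set} (R? : ∀ x y → Dec (R x y)) where

  count-flip-∷ : ∀ x xs ys →
    sum (map (λ y → count (λ x → R? x y) (x ∷ xs)) ys) ≡ count (R? x) ys + sum (map (λ y → count (λ x → R? x y) xs) ys)
  count-flip-∷ x xs []       = refl
  count-flip-∷ x xs (y ∷ ys) with ih ← count-flip-∷ x xs ys | R? x y
  ... | yes _ = cong suc (trans (cong (count (λ x → R? x y) xs +_) ih) (+-swap (count (λ x → R? x y) xs) (count (R? x) ys) _))
  ... | no  _ = trans (cong (count (λ x → R? x y) xs +_) ih) (+-swap (count (λ x → R? x y) xs) (count (R? x) ys) _)

  double-count : ∀ xs ys → sum (map (λ x → count (R? x) ys) xs) ≡ sum (map (λ y → count (λ x → R? x y) xs) ys)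
  double-count []       ys = sym (sum-0 ys)
    where
    sum-0 : ∀ (ys : List B) → sum (map (λ _ → 0) ys) ≡ 0
    sum-0 []       = refl
    sum-0 (_ ∷ ys) = sum-0 ys
  double-count (x ∷ xs) ys = trans (cong (count (R? x) ys +_) (double-count xs ys)) (sym (count-flip-∷ x xs ys))

module _ {A : Set} (f : A → ℕ) where

  sum-≤ : ∀ {β xs} → All (λ x → f x ≤ β) xs → sum (map f xs) ≤ length xs * β
  sum-≤ []       = z≤n
  sum-≤ (p ∷ ps) = +-mono-≤ p (sum-≤ ps)

  markov : ∀ {P : A → Set} (P? : Decidable P) γ → (∀ {x} → P x → γ ≤ f x) →
    ∀ xs → count P? xs * γ ≤ sum (map f xs)
  markov P? γ big []       = z≤n
  markov P? γ big (x ∷ xs) with P? x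
  ... | yes Px = +-mono-≤ (big Px) (markov P? γ big xs)
  ... | no  _  = ≤-trans (markov P? γ big xs) (m≤n+m _ (f x))

  -- Markov's inequality: if more than half of the values were at least `2 * β + 1`, they alone
  -- would sum to more than `length xs * β`.
  half-small : ∀ β xs → sum (map f xs) ≤ length xs * β →
    2 * count (λ x → ¬? (f x ≤? 2 * β)) xs ≤ length xs
  half-small β xs sum≤ with bad ← count (λ x → ¬? (f x ≤? 2 * β)) xs | mk ← markov (λ x → ¬? (f x ≤? 2 * β)) (suc (2 * β)) ≰⇒> xs = ≮⇒≥ λ lt →
    <⇒≱ (begin-strict
      length xs * β      ≤⟨ *-monoˡ-≤ β (<⇒≤ lt) ⟩
      2 * bad * β        ≡⟨ lemma bad β ⟩
      bad * (2 * β)      <⟨ m<n+m _ (bad>0 lt) ⟩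
      bad + bad * (2 * β) ≡⟨ *-suc bad (2 * β) ⟨
      bad * suc (2 * β)  ≤⟨ mk ⟩
      sum (map f xs)     ∎) sum≤
    where
    open ≤-Reasoning
    lemma : ∀ a b → 2 * a * b ≡ a * (2 * b)
    lemma = solve-∀
    bad>0 : ∀ {n m} → n < 2 * m → 0 < m
    bad>0 {m = suc m} _ = s≤s z≤n

-- Tiling by second-coloured copies: cliques and greedy covers.

module Tiling {V : Set} (col : V → V → Colour) (col-sym : ∀ u v → col u v ≡ col v u)
  (k s M : ℕ) (s<k : s < k) (M-big : 2 ^ (k + 2 * k) ≤ M) (no-first : ∀ ys → length ys ≡ k → ¬ Ramsey.Clique col first ys)
  (Copy : List V → Set) (copy : ∀ ys → length ys ≡ suc s → Ramsey.Clique col second ys → Copy ys)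
  where

  open Ramsey col

  private
    h : ℕ
    h = suc s

  private module ↭-Solver = CommutativeMonoidSolver (++-commutativeMonoid {A = V})
  open ↭-Solver using (_⊕_; _⊜_)

  Clique-↭ : ∀ {c xs ys} → xs ↭ ys → Clique c xs → Clique c ys
  Clique-↭ = AllPairs-↭ (λ {x} {y} e → trans (col-sym y x) e)

  abstract
    -- As there is no first-coloured clique of size `k`, Ramsey's theorem gives a second-coloured
    -- one of size `2 * k`, which is trimmed to `l`. The map `t` permits an application to blocks
    -- through their first vertices.
    second-clique : ∀ {X : Set} (t : X → V) l → l ≤ 2 * k → ∀ xs → M ≤ length xs →
      Part (λ ys → length ys ≡ l × AllPairs (λ x y → col (t x) (t y) ≡ second) ys) xs
    second-clique t l l≤2k xs big with Ramsey.ramsey (λ x y → col (t x) (t y)) k (2 * k) xs (≤-trans M-big big)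
    ... | inj₁ (ys , _ , _ , ∣ys∣ , cl) = contradiction (AllPairs.map⁺ cl) (no-first (map t ys) (trans (List.length-map t ys) ∣ys∣))
    ... | inj₂ (ys , zs , p , ∣ys∣ , cl) = take l ys , drop l ys ++ zs ,
      ↭-trans p (↭-reflexive (trans (cong (_++ zs) (sym (List.take++drop≡id l ys))) (List.++-assoc (take l ys) _ zs))) ,
      trans (List.length-take l ys) (m≤n⇒m⊓n≡m (subst (l ≤_) (sym ∣ys∣) l≤2k)) , AllPairs.take⁺ l cl

  s≤2k : s ≤ 2 * k
  s≤2k = ≤-trans (<⇒≤ s<k) (m≤n*m k 2)

  h≤2k : h ≤ 2 * k
  h≤2k = ≤-trans s<k (m≤n*m k 2)

  2h≤2k : 2 * h ≤ 2 * k
  2h≤2k = *-monoʳ-≤ 2 s<k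

  second-copy : ∀ xs → M ≤ length xs → Part (λ ys → length ys ≡ h × Copy ys) xs
  second-copy xs big with ys , zs , p , ∣ys∣ , cl ← second-clique id h h≤2k xs big = ys , zs , p , ∣ys∣ , copy ys ∣ys∣ cl

  -- Only the number of uncovered vertices is recorded; the number of copies follows by counting, in
  -- `copies`.
  data Cov (ℓ : ℕ) (xs : List V) : Set where
    rest : length xs ≤ ℓ → Cov ℓ xs
    tile : ∀ {ys zs} → xs ↭ ys ++ zs → Copy ys → Cov ℓ zs → Cov ℓ xs

  module _ {ℓ : ℕ} where

    Cov-↭ : ∀ {xs ys} → xs ↭ ys → Cov ℓ ys → Cov ℓ xs
    Cov-↭ p (rest le)    = rest (subst (_≤ ℓ) (sym (↭-length p)) le)
    Cov-↭ p (tile q c r) = tile (↭-trans p q) c r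

    Cov-tiles : ∀ {bs zs} → All (λ b → length b ≡ h × Copy b) bs → Cov ℓ zs → Cov ℓ (concat bs ++ zs)
    Cov-tiles []                   r = r
    Cov-tiles {b ∷ bs} ((_ , c) ∷ cs) r = tile (↭-reflexive (List.++-assoc b (concat bs) _)) c (Cov-tiles cs r)

    -- Each vertex of `L` is completed to a copy by `s` of its second-coloured neighbours in `R`.
    -- This costs every later vertex at most `s` neighbours, hence the term `length L * s`, and `M`
    -- remaining ones suffice for `second-clique`. `P` records what the surviving part of `R`
    -- inherits.
    Cov-with : ∀ (P : V → Set) L R Z → All P R →
      All (λ v → M + length L * s ≤ length (side second v R)) L →
      (∀ R′ → All P R′ → Cov ℓ (R′ ++ Z)) → Cov ℓ (L ++ R ++ Z)
    Cov-with P []      R Z PR _              cov = cov R PR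
    Cov-with P (v ∷ L) R Z PR (v-many ∷ many) cov
      with ys , ws , p , ∣ys∣ , cl ← second-clique id s s≤2k (side second v R) (≤-trans (m≤m+n M _) v-many)
      with us , q ← side-split′ second v R =
      tile perm (copy (v ∷ ys) (cong suc ∣ys∣)
             (proj₁ (All-↭-++ ys p (All.all-filter (λ w → col v w ≟ᶜ second) R)) ∷ cl))
        (Cov-with P L (ws ++ us) Z (proj₂ (All-↭-++ ys r PR)) (All.map fewer many) cov)
      where
      r : R ↭ ys ++ ws ++ us
      r = ↭-trans q (↭-trans (++⁺ʳ us p) (↭-reflexive (List.++-assoc ys ws us)))
      perm : v ∷ L ++ R ++ Z ↭ (v ∷ ys) ++ L ++ (ws ++ us) ++ Z
      perm = prep v (↭-trans (++⁺ˡ L (++⁺ʳ Z r))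
               (↭-Solver.solve 4 (λ L y w z → L ⊕ ((y ⊕ w) ⊕ z) ⊜ y ⊕ (L ⊕ (w ⊕ z))) ↭-refl L ys (ws ++ us) Z))
      fewer : ∀ {v′} → M + (s + length L * s) ≤ length (side second v′ R) →
        M + length L * s ≤ length (side second v′ (ws ++ us))
      fewer {v′} le = +-cancelˡ-≤ s _ _ (begin
        s + (M + length L * s)  ≡⟨ +-swap s M _ ⟩
        M + (s + length L * s)  ≤⟨ le ⟩
        length (side second v′ R)  ≡⟨ count-↭-++ (λ w → col v′ w ≟ᶜ second) ys r ⟩
        length (side second v′ ys) + length (side second v′ (ws ++ us))
          ≤⟨ +-monoˡ-≤ _ (≤-trans (List.length-filter _ ys) (≤-reflexive ∣ys∣)) ⟩
        s + length (side second v′ (ws ++ us)) ∎)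
        where open ≤-Reasoning

  -- Blocks and the exchange of their first vertices.

  Block : Set
  Block = V × List V

  -- A clique on 2|H| vertices, of which `t` is set apart as the one to be replaced.
  IsBlock : Block → Set
  IsBlock (t , Q) = length Q ≡ s + h × Clique second (t ∷ Q)

  -- Together with `w`, `s` such neighbours form a copy. The first vertex of the block is left out
  -- of the count because `w` is to take its place.
  Attached : V → Block → Set
  Attached w (_ , Q) = s ≤ length (side second w Q)

  abstract

    Attached? : ∀ w b → Dec (Attached w b)
    Attached? w (_ , Q) = s ≤? length (side second w Q)

  verts : List Block → List V
  verts Ps = concat (map (uncurry _∷_) Ps)

  verts-↭ : ∀ {Ps Ps′} → Ps ↭ Ps′ → verts Ps ↭ verts Ps′
  verts-↭ _↭_.refl = ↭-refl
  verts-↭ (_↭_.prep (t , Q) p) = ++⁺ˡ (t ∷ Q) (verts-↭ p)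
  verts-↭ {Ps′ = _ ∷ _ ∷ ys} (_↭_.swap (t , Q) (t′ , Q′) p) = ↭-trans (++⁺ˡ (t ∷ Q) (++⁺ˡ (t′ ∷ Q′) (verts-↭ p)))
    (↭-Solver.solve 3 (λ a b c → a ⊕ (b ⊕ c) ⊜ b ⊕ (a ⊕ c)) ↭-refl (t ∷ Q) (t′ ∷ Q′) (verts ys))
  verts-↭ (_↭_.trans p q) = ↭-trans (verts-↭ p) (verts-↭ q)

  verts-++ : ∀ Ps Ps′ → verts (Ps ++ Ps′) ↭ verts Ps ++ verts Ps′
  verts-++ Ps Ps′ = ↭-reflexive (trans (cong concat (List.map-++ (uncurry _∷_) Ps Ps′))
    (sym (List.concat-++ (map (uncurry _∷_) Ps) _)))

  non : V → List Block → ℕ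
  non w = count (λ b → ¬? (Attached? w b))

  back : List Block → Block → ℕ
  back Ps b = count (λ b′ → ¬? (Attached? (proj₁ b′) b)) Ps

  abstract

    -- At most `β` blocks are excluded because `w` is not attached to them, and at most `2 * β`
    -- because their first vertices are not attached to `b′`; some block remains.
    link : ∀ {w β Ps} b′ → non w Ps ≤ β → back Ps b′ ≤ 2 * β → β + 2 * β < length Ps →
      ∃ λ b → b ∈ Ps × Attached w b × Attached (proj₁ b) b′
    link {w} {β} {Ps} b′ w≤ b′≤ big =
      let b , b∈ , ¬¬att = count<⇒∁ (λ b → ¬? (Attached? (proj₁ b) b′)) (filter (Attached? w) Ps)
                             (remainder (count-∁ (Attached? w) Ps) w≤ back≤ big)
          b∈Ps , att = ∈.∈-filter⁻ (Attached? w) {xs = Ps} b∈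
      in b , b∈Ps , att , decidable-stable (Attached? (proj₁ b) b′) ¬¬att
      where
      back≤ : back (filter (Attached? w) Ps) b′ ≤ 2 * β
      back≤ = ≤-trans (count-mono-↭ (λ b → ¬? (Attached? (proj₁ b) b′)) (filter (∁? (Attached? w)) Ps)
        (↭-trans (filter-split (Attached? w) Ps) (++-comm (filter (Attached? w) Ps) _))) b′≤

    -- By double counting, the sum of `back` over the blocks is the sum of `non` over their first
    -- vertices, so its average is at most `β`; hence at most half of the blocks exceed `2 * β`.
    half-good : ∀ {m} β Ps → All (λ b → non (proj₁ b) Ps ≤ β) Ps → 2 * m ≤ length Ps →
      m ≤ length (filter (λ b → back Ps b ≤? 2 * β) Ps)
    half-good {m} β Ps Ps≤ big = half (count-∁ (λ b → back Ps b ≤? 2 * β) Ps) bad≤ big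
      where
      bad≤ : 2 * count (λ b → ¬? (back Ps b ≤? 2 * β)) Ps ≤ length Ps
      bad≤ = half-small (back Ps) β Ps (subst (_≤ length Ps * β)
        (double-count (λ b b′ → ¬? (Attached? (proj₁ b) b′)) Ps Ps) (sum-≤ (λ b → non (proj₁ b) Ps) Ps≤))

    -- Provides one round of `absorb`: the first vertices of these blocks will form a copy, and each
    -- block can be reached by `link`.
    goodTile : ∀ β Ps → All (λ b → non (proj₁ b) Ps ≤ β) Ps → 2 * M ≤ length Ps →
      Part (λ T → (length T ≡ h × AllPairs (λ b b′ → col (proj₁ b) (proj₁ b′) ≡ second) T) ×
                  All (λ b → back Ps b ≤ 2 * β) T) Ps
    goodTile β Ps Ps≤ big = Part-filter (λ b → back Ps b ≤? 2 * β)
      (second-clique proj₁ h h≤2k _ (half-good β Ps Ps≤ big))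

  module _ {ℓ : ℕ} where

    -- `w` forms one copy with `s` of its second-coloured neighbours in `Q`, and the other `h`
    -- vertices of `Q` form a second one.
    Cov-block : ∀ {w t Q zs} → IsBlock (t , Q) → Attached w (t , Q) → Cov ℓ zs → Cov ℓ ((w ∷ Q) ++ zs)
    Cov-block {w} {t} {Q} {zs} (∣Q∣ , _ ∷ cl) att cov
      with us , q ← side-split′ second w Q =
      tile (prep w (↭-trans (++⁺ʳ zs r) (↭-reflexive (List.++-assoc ys Q′ zs))))
        (copy (w ∷ ys) (cong suc ∣ys∣) (All.take⁺ s (All.all-filter (λ v → col w v ≟ᶜ second) Q) ∷ proj₁ cls))
        (tile ↭-refl (copy Q′ ∣Q′∣ (proj₁ (proj₂ cls))) cov)
      where
      S = side second w Q
      ys = take s S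
      Q′ = drop s S ++ us
      ∣ys∣ : length ys ≡ s
      ∣ys∣ = trans (List.length-take s S) (m≤n⇒m⊓n≡m att)
      r : Q ↭ ys ++ Q′
      r = ↭-trans q (↭-reflexive (trans (cong (_++ us) (sym (List.take++drop≡id s S))) (List.++-assoc ys _ us)))
      ∣Q′∣ : length Q′ ≡ h
      ∣Q′∣ = +-cancelˡ-≡ s _ _ (trans (cong (_+ length Q′) (sym ∣ys∣)) (trans (sym (↭-length-++ ys r)) ∣Q∣))
      cls = AllPairs-++⁻ ys (Clique-↭ r cl)

    own : ∀ {b} → IsBlock b → Attached (proj₁ b) b
    own {t , Q} (∣Q∣ , all-second ∷ _) = subst (s ≤_)
      (sym (trans (cong length (List.filter-all (λ v → col t v ≟ᶜ second) all-second)) ∣Q∣)) (m≤m+n s h)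

    Cov-blocks : ∀ {Ps zs} → All IsBlock Ps → Cov ℓ zs → Cov ℓ (verts Ps ++ zs)
    Cov-blocks []                     cov = cov
    Cov-blocks {(t , Q) ∷ Ps} {zs} (isb ∷ isbs) cov =
      Cov-↭ (↭-reflexive (List.++-assoc (t ∷ Q) (verts Ps) zs)) (Cov-block isb (own isb) (Cov-blocks isbs cov))

    -- Each vertex w of ws replaces the vertex t of some block (t , Q), and t in turn
    -- replaces the first vertex of the corresponding block of T.
    exchange : ∀ β ws T Ps Z → length ws ≡ length T → All IsBlock Ps → All IsBlock T →
      All (λ w → non w Ps ≤ β) ws → All (λ b → back Ps b ≤ 2 * β) T →
      β + 2 * β + length ws ≤ length Ps →
      (∀ S Ps′ → Ps ↭ S ++ Ps′ → length S ≡ length ws → Cov ℓ (map proj₁ T ++ verts Ps′ ++ Z)) →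
      Cov ℓ (ws ++ verts T ++ verts Ps ++ Z)
    exchange β [] [] Ps Z _ _ _ _ _ _ cov = cov [] Ps ↭-refl refl
    exchange β (w ∷ ws) ((t′ , Q′) ∷ T) Ps Z eq isPs (isT ∷ isTs) (w≤ ∷ ws≤) (T≤ ∷ Ts≤) big cov
      with (t , Q) , b∈Ps , att , att′ ← link {Ps = Ps} (t′ , Q′) w≤ T≤ (≤-trans (m<m+n (β + 2 * β) (s≤s z≤n)) big)
      with Ps₁ , p ← ↭-pick b∈Ps
      with isb ∷ isPs₁ ← All-resp-↭ p isPs =
      Cov-↭ perm
        (Cov-block isb att (Cov-block isT att′
          -- The freed vertex `t′` is parked in `Z` until the continuation receives all freed
          -- vertices together.
          (exchange β ws T Ps₁ (t′ ∷ Z) (suc-injective eq) isPs₁ isTs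
            (All.map (λ {v} → ≤-trans (count-mono-↭ (λ b → ¬? (Attached? v b)) [ t , Q ] p)) ws≤)
            (All.map (λ {b} → ≤-trans (count-mono-↭ (λ b′ → ¬? (Attached? (proj₁ b′) b)) [ t , Q ] p)) Ts≤)
            (≤-pred (subst₂ _≤_ (+-suc _ _) (↭-length p) big))
            λ S Ps′ q ∣S∣ → Cov-↭
              (↭-Solver.solve 4 (λ T P t Z → T ⊕ (P ⊕ (t ⊕ Z)) ⊜ t ⊕ (T ⊕ (P ⊕ Z))) ↭-refl (map proj₁ T) (verts Ps′) [ t′ ] Z)
              (cov ((t , Q) ∷ S) Ps′ (↭-trans p (prep _ q)) (cong suc ∣S∣)))))
      where
      perm : (w ∷ ws) ++ verts ((t′ , Q′) ∷ T) ++ verts Ps ++ Z ↭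
        (w ∷ Q) ++ (t ∷ Q′) ++ ws ++ verts T ++ verts Ps₁ ++ t′ ∷ Z
      perm = ↭-trans (++⁺ˡ (w ∷ ws) (++⁺ˡ (verts ((t′ , Q′) ∷ T)) (++⁺ʳ Z (verts-↭ p))))
        (↭-Solver.solve 9 (λ w ws t′ Q′ T t Q P Z →
            (w ⊕ ws) ⊕ (((t′ ⊕ Q′) ⊕ T) ⊕ (((t ⊕ Q) ⊕ P) ⊕ Z)) ⊜
            (w ⊕ Q) ⊕ ((t ⊕ Q′) ⊕ (ws ⊕ (T ⊕ (P ⊕ (t′ ⊕ Z))))))
          ↭-refl [ w ] ws [ t′ ] Q′ (verts T) [ t ] Q (verts Ps₁) Z)

    -- Each round trades `h` vertices of `L` for the first vertices of a `goodTile`, which form a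
    -- copy. It uses up `2 * h` blocks, those of the tile and the intermediate ones, and the term
    -- `2 * length L` pays for them. The bound `β` stays valid because removing blocks only lowers
    -- `non`.
    absorb : ∀ β L Ps Z → length Z + s ≤ ℓ → All IsBlock Ps →
      All (λ w → non w Ps ≤ β) L → All (λ b → non (proj₁ b) Ps ≤ β) Ps →
      2 * length L + (2 * M + (β + 2 * β + 2 * h)) ≤ length Ps →
      Cov ℓ (L ++ verts Ps ++ Z)
    absorb β L Ps Z Z≤ isPs L≤ Ps≤ big = go L Ps isPs L≤ Ps≤ big (<-wellFounded (length L))
      where
      enough : ∀ {a b m n} → m + (a + b) ≤ n → a ≤ n
      enough {a} {b} {m} = ≤-trans (≤-trans (m≤m+n a b) (m≤n+m (a + b) m))

      go : ∀ L Ps → All IsBlock Ps →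
        All (λ w → non w Ps ≤ β) L → All (λ b → non (proj₁ b) Ps ≤ β) Ps →
        2 * length L + (2 * M + (β + 2 * β + 2 * h)) ≤ length Ps →
        Acc _<_ (length L) → Cov ℓ (L ++ verts Ps ++ Z)
      go L Ps isPs L≤ Ps≤ big (acc rec) with h ≤? length L
      -- At most `s` vertices of `L` are left; they stay uncovered together with `Z`.
      ... | no h≰ = Cov-↭ (↭-Solver.solve 3 (λ L P Z → L ⊕ (P ⊕ Z) ⊜ P ⊕ (Z ⊕ L)) ↭-refl L (verts Ps) Z)
        (Cov-blocks isPs (rest (≤-trans (≤-reflexive (List.length-++ Z)) (≤-trans (+-monoʳ-≤ (length Z) (≤-pred (≰⇒> h≰))) Z≤))))
      ... | yes h≤ with T , Ps₁ , p , (∣T∣ , cl) , T≤ ← goodTile β Ps Ps≤ (enough {m = 2 * length L} big) =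
        Cov-↭ perm (exchange β ws T Ps₁ (L′ ++ Z) (trans ∣ws∣ (sym ∣T∣)) (proj₂ isPs′) (proj₁ isPs′)
          (All.map (λ {w} → ≤-trans (non-mono w T p)) (proj₁ L≤′))
          (All.map (λ {b} → ≤-trans (count-mono-↭ (λ b′ → ¬? (Attached? (proj₁ b′) b)) T p)) T≤)
          room cont)
        where
        ws = take h L
        L′ = drop h L
        ∣ws∣ : length ws ≡ h
        ∣ws∣ = trans (List.length-take h L) (m≤n⇒m⊓n≡m h≤)
        L≡ : L ≡ ws ++ L′
        L≡ = sym (List.take++drop≡id h L)
        ∣L∣ : length L ≡ h + length L′
        ∣L∣ = trans (cong length L≡) (trans (List.length-++ ws) (cong (_+ length L′) ∣ws∣))
        L≤′ = All-↭-++ ws (↭-reflexive L≡) L≤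
        isPs′ = All-↭-++ T p isPs
        ∣Ps∣ : length Ps ≡ h + length Ps₁
        ∣Ps∣ = trans (↭-length-++ T p) (cong (_+ length Ps₁) ∣T∣)
        non-mono : ∀ w {Ps} T {Ps₁} → Ps ↭ T ++ Ps₁ → non w Ps₁ ≤ non w Ps
        non-mono w T = count-mono-↭ (λ b → ¬? (Attached? w b)) T
        room : β + 2 * β + length ws ≤ length Ps₁
        room = +-cancelˡ-≤ h _ _ (begin
          h + (β + 2 * β + length ws)    ≡⟨ cong (λ l → h + (β + 2 * β + l)) ∣ws∣ ⟩
          h + (β + 2 * β + h)            ≤⟨ m≤n+m _ (2 * length L + 2 * M) ⟩
          2 * length L + 2 * M + (h + (β + 2 * β + h))  ≡⟨ lemma (2 * length L) (2 * M) (β + 2 * β) h ⟩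
          2 * length L + (2 * M + (β + 2 * β + 2 * h))  ≤⟨ big ⟩
          length Ps                      ≡⟨ ∣Ps∣ ⟩
          h + length Ps₁                 ∎)
          where
          open ≤-Reasoning
          lemma : ∀ a m b h → a + m + (h + (b + h)) ≡ a + (m + (b + 2 * h))
          lemma = solve-∀
        perm : L ++ verts Ps ++ Z ↭ ws ++ verts T ++ verts Ps₁ ++ L′ ++ Z
        perm = ↭-trans (++⁺ (↭-reflexive L≡) (++⁺ʳ Z (↭-trans (verts-↭ p) (verts-++ T Ps₁))))
          (↭-Solver.solve 5 (λ w L T P Z → (w ⊕ L) ⊕ ((T ⊕ P) ⊕ Z) ⊜ w ⊕ (T ⊕ (P ⊕ (L ⊕ Z)))) ↭-refl ws L′ (verts T) (verts Ps₁) Z)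
        cont : ∀ S Ps′ → Ps₁ ↭ S ++ Ps′ → length S ≡ length ws → Cov ℓ (map proj₁ T ++ verts Ps′ ++ L′ ++ Z)
        cont S Ps′ r ∣S∣ = tile ↭-refl (copy (map proj₁ T) (trans (List.length-map proj₁ T) ∣T∣) (AllPairs.map⁺ cl))
          (Cov-↭ (↭-Solver.solve 3 (λ P L Z → P ⊕ (L ⊕ Z) ⊜ L ⊕ (P ⊕ Z)) ↭-refl (verts Ps′) L′ Z)
            (go L′ Ps′ (proj₂ (All-↭-++ S r (proj₂ isPs′)))
              (All.map (λ {w} → ≤-trans (≤-trans (non-mono w S r) (non-mono w T p))) (proj₂ L≤′))
              (All.map (λ {b} → ≤-trans (≤-trans (non-mono (proj₁ b) S r) (non-mono (proj₁ b) T p)))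
                (proj₂ (All-↭-++ S r (proj₂ (All-↭-++ T p Ps≤)))))
              (+-cancelˡ-≤ (2 * h) _ _ (begin
                2 * h + (2 * length L′ + K)   ≡⟨ lemma h (length L′) K ⟩
                2 * (h + length L′) + K       ≡⟨ cong (λ l → 2 * l + K) ∣L∣ ⟨
                2 * length L + K              ≤⟨ big ⟩
                length Ps                     ≡⟨ ∣Ps∣ ⟩
                h + length Ps₁                ≡⟨ cong (h +_) (↭-length-++ S r) ⟩
                h + (length S + length Ps′)   ≡⟨ cong (λ l → h + (l + length Ps′)) (trans ∣S∣ ∣ws∣) ⟩
                h + (h + length Ps′)          ≡⟨ lemma′ h (length Ps′) ⟩
                2 * h + length Ps′            ∎))
              (rec (subst (length L′ <_) (sym ∣L∣) (s≤s (m≤n+m _ s))))))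
          where
          open ≤-Reasoning
          K = 2 * M + (β + 2 * β + 2 * h)
          lemma : ∀ h l k → 2 * h + (2 * l + k) ≡ 2 * (h + l) + k
          lemma = solve-∀
          lemma′ : ∀ h p → h + (h + p) ≡ 2 * h + p
          lemma′ = solve-∀

  -- In a block that `w` is not attached to, fewer than `s` of the `s + h` vertices of `Q` are
  -- joined to `w` in the second colour, so at least `h` in the first.
  non-≤ : ∀ w {Ps} → All IsBlock Ps → non w Ps * h ≤ length (side first w (verts Ps))
  non-≤ w [] = z≤n
  non-≤ w {(t , Q) ∷ Ps} ((∣Q∣ , _) ∷ isPs) = begin
      non w ((t , Q) ∷ Ps) * h                         ≤⟨ step ⟩
      length (side first w Q) + non w Ps * h           ≤⟨ +-mono-≤ first-Q (non-≤ w isPs) ⟩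
      length (side first w (t ∷ Q)) + length (side first w (verts Ps))
                                                        ≡⟨ count-++ (λ v → col w v ≟ᶜ first) (t ∷ Q) (verts Ps) ⟨
      length (side first w (t ∷ Q ++ verts Ps))        ∎
    where
    open ≤-Reasoning
    first-Q : length (side first w Q) ≤ length (side first w (t ∷ Q))
    first-Q = count-mono-↭ (λ v → col w v ≟ᶜ first) [ t ] ↭-refl
    step : non w ((t , Q) ∷ Ps) * h ≤ length (side first w Q) + non w Ps * h
    step with Attached? w (t , Q)
    ... | yes _ = m≤n+m _ _
    ... | no ¬att = +-monoˡ-≤ _ (+-cancelˡ-≤ s _ _ (begin
      s + h                                                     ≡⟨ ∣Q∣ ⟨
      length Q                                                  ≡⟨ ↭-length-++ (side first w Q) (side-split w Q) ⟩
      length (side first w Q) + length (side second w Q)        ≤⟨ +-monoʳ-≤ _ (<⇒≤ (≰⇒> ¬att)) ⟩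
      length (side first w Q) + s                               ≡⟨ +-comm _ s ⟩
      s + length (side first w Q)                               ∎))

  -- The absorber and the complete cover.

  toBlocks : ∀ {bs} → All (λ b → length b ≡ suc (s + h) × Clique second b) bs →
    ∃ λ Ps → verts Ps ≡ concat bs × All IsBlock Ps × length (concat bs) ≡ length Ps * suc (s + h)
  toBlocks [] = [] , refl , [] , refl
  toBlocks {(t ∷ Q) ∷ bs} ((∣b∣ , cl) ∷ cls) =
    let Ps , vs , isPs , ∣bs∣ = toBlocks cls in
    (t , Q) ∷ Ps , cong ((t ∷ Q) ++_) vs , (suc-injective ∣b∣ , cl) ∷ isPs ,
    trans (List.length-++ (t ∷ Q)) (cong₂ _+_ ∣b∣ ∣bs∣)

  abstract

    blocks-exist : ∀ xs → ∃ λ Ps → ∃ λ zs → xs ↭ verts Ps ++ zs × All IsBlock Ps × length zs < M ×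
      length xs ≡ length Ps * suc (s + h) + length zs
    blocks-exist xs =
      let bs , zs , p , cls , zs< = greedy′ M (s + h) (second-clique id (suc (s + h)) (≤-trans (≤-reflexive eq) 2h≤2k)) xs
          Ps , vs , isPs , ∣bs∣ = toBlocks cls
      in Ps , zs , ↭-trans p (++⁺ʳ zs (↭-reflexive (sym vs))) , isPs , zs< ,
         trans (↭-length-++ (concat bs) p) (cong (_+ length zs) ∣bs∣)
      where
      eq : suc (s + h) ≡ 2 * h
      eq = cong (h +_) (sym (+-identityʳ h))

  -- `R` is the reservoir. In `enough`, the first `2 * M` pays for the leftovers handed to `absorb`,
  -- fewer than `M`; the rest is the reserve that every round needs.
  record Absorber (U : List V) : Set where
    field
      Ps           : List Block
      R            : List V
      split        : U ↭ verts Ps ++ R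
      isPs         : All IsBlock Ps
      β            : ℕ
      non-attached : All (λ w → non w Ps ≤ β) U
      enough       : 2 * M + (2 * M + (β + 2 * β + 2 * h)) ≤ length Ps
      large        : length U ≤ 2 * length R

  abstract

    absorber : ∀ U → All (λ v → 64 * length (side first v U) ≤ length U) U →
      4 * h * (8 * M + 4 * h) + 2 * M ≤ length U → Absorber U
    absorber U sparse big =
      let Ps , zs , p , isPs , zs< , ∣U₁∣ = blocks-exist U₁
          ∣U₁∣′ = trans (sym (trans (List.length-take ⌊ u /2⌋ U) (m≤n⇒m⊓n≡m (⌊n/2⌋≤n u)))) ∣U₁∣
          q = ↭-trans (↭-reflexive (sym (List.take++drop≡id ⌊ u /2⌋ U)))
                (↭-trans (++⁺ʳ U₂ p) (↭-reflexive (List.++-assoc (verts Ps) zs U₂)))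
          u≤ = half-blocks≤ {s} {length Ps} {M = M} ∣U₁∣′ zs<
          m≥ = blocks≥ {s} {length Ps} {M = M} big u≤
      in record
        { Ps = Ps
        -- The vertices of the cut half that no block takes join the reservoir.
        ; R = zs ++ U₂
        ; split = q
        ; isPs = isPs
        -- One sixth follows from the degree bound 1/64 by `non≤sixth` and keeps `β + 2 * β` within
        -- half of the blocks, as `sixths≤` needs.
        ; β = length Ps / 6
        ; non-attached = All.map (λ {w} few → non≤sixth {s} {length Ps} {M = M}
            (≤-trans (non-≤ w isPs) (≤-trans (m≤m+n _ _) (≤-reflexive (sym (count-↭-++ (λ v → col w v ≟ᶜ first) (verts Ps) q)))))
            few u≤ m≥) sparse
        ; enough = sixths≤ {M} {h} m≥
        ; large = ≤-trans (half≤ (⌊ u /2⌋) (⌊n/2⌋*2≤ u) (≤-reflexive (trans (cong length (sym (List.take++drop≡id ⌊ u /2⌋ U)))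
            (trans (List.length-++ U₁) (cong (_+ length U₂) (trans (List.length-take ⌊ u /2⌋ U) (m≤n⇒m⊓n≡m (⌊n/2⌋≤n u))))))))
            (*-monoʳ-≤ 2 (≤-trans (m≤n+m (length U₂) (length zs)) (≤-reflexive (sym (List.length-++ zs)))))
        }
      where
      u : ℕ
      u = length U
      U₁ U₂ : List V
      U₁ = take ⌊ u /2⌋ U
      U₂ = drop ⌊ u /2⌋ U

    -- Vertices of `O` with few second-coloured neighbours in `R` are tiled down to at most `r`, the
    -- other vertices of `O` down to fewer than `M`. The latter are completed inside `R`, what is
    -- left of `R` is tiled down to fewer than `M`, and absorption leaves at most `s` of these.
    cover : ∀ {ℓ r U O} (Ab : Absorber U) → let open Absorber Ab in
      r + s ≤ ℓ →
      (∀ A Z → U ++ O ↭ A ++ R ++ Z → All (λ v → length (side second v R) < M + M * s) A → r < length A →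
        Part (λ ys → length ys ≡ h × Copy ys) A) →
      Cov ℓ (U ++ O)
    cover {ℓ} {r} {U} {O} Ab r+s≤ℓ find =
      let bsA , A′ , pA , tA , A′< , _ = greedy Few Few-rest (suc r) s (λ A φ → find A (proj₁ φ) (proj₁ (proj₂ φ)) (proj₂ (proj₂ φ)))
                                           A (E ++ verts Ps , perm , All.all-filter few? O)
          bsE , L , pE , tE , L< = greedy′ M s second-copy E
      in Cov-↭ (↭-trans perm (↭-trans (++⁺ pA (++⁺ˡ R (++⁺ʳ (verts Ps) pE)))
           (↭-Solver.solve 6 (λ a A R e L P → (a ⊕ A) ⊕ (R ⊕ ((e ⊕ L) ⊕ P)) ⊜ a ⊕ (e ⊕ (L ⊕ (R ⊕ (P ⊕ A))))) ↭-refl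
             (concat bsA) A′ R (concat bsE) L (verts Ps))))
         (Cov-tiles tA (Cov-tiles tE
           (Cov-with (λ w → non w Ps ≤ β) L R (verts Ps ++ A′) (proj₂ (All-↭-++ (verts Ps) split non-attached))
             -- This is the reason for the threshold `M + M * s`: fewer than `M` vertices of `L`
             -- take `s` vertices of `R` each.
             (All.map (λ {v} ¬few → ≤-trans (+-monoʳ-≤ M (*-monoˡ-≤ s (<⇒≤ L<))) (≮⇒≥ ¬few))
               (proj₂ (All-↭-++ (concat bsE) pE (All.all-filter (∁? few?) O))))
             λ R′ R′≤ → finish R′ A′ R′≤ A′<)))
      where
      open Absorber Ab
      few? : Decidable (λ v → length (side second v R) < M + M * s)
      few? v = length (side second v R) <? M + M * s
      A E : List V
      A = filter few? O
      E = filter (∁? few?) O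
      -- The complement `Z` is kept in the invariant because `find` asks how `A` and `R` lie in
      -- `U ++ O`; from this their disjointness can be deduced.
      Few : List V → Set
      Few A = ∃ λ Z → U ++ O ↭ A ++ R ++ Z × All (λ v → length (side second v R) < M + M * s) A
      Few-rest : ∀ {xs} ys {zs} → xs ↭ ys ++ zs → Few xs → Few zs
      Few-rest ys {zs} p (Z , q , few) = ys ++ Z ,
        ↭-trans q (↭-trans (++⁺ʳ (R ++ Z) p)
          (↭-Solver.solve 4 (λ y z R Z → (y ⊕ z) ⊕ (R ⊕ Z) ⊜ z ⊕ (R ⊕ (y ⊕ Z))) ↭-refl ys zs R Z)) ,
        proj₂ (All-↭-++ ys p few)
      perm : U ++ O ↭ A ++ R ++ E ++ verts Ps
      perm = ↭-trans (++⁺ split (filter-split few? O))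
        (↭-Solver.solve 4 (λ P R A E → (P ⊕ R) ⊕ (A ⊕ E) ⊜ A ⊕ (R ⊕ (E ⊕ P))) ↭-refl (verts Ps) R A E)
      finish : ∀ R′ A′ → All (λ w → non w Ps ≤ β) R′ → length A′ < suc r → Cov ℓ (R′ ++ verts Ps ++ A′)
      finish R′ A′ R′≤ A′< =
        let bs , L , p , t , L< = greedy′ M s second-copy R′ in
        Cov-↭ (↭-trans (++⁺ʳ (verts Ps ++ A′) p) (↭-reflexive (List.++-assoc (concat bs) L _)))
          (Cov-tiles t (absorb β L Ps A′ (≤-trans (+-monoˡ-≤ s (≤-pred A′<)) r+s≤ℓ) isPs
            (proj₂ (All-↭-++ (concat bs) p R′≤))
            (All.map⁻ {f = proj₁} ((heads Ps (proj₁ (All-↭-++ (verts Ps) split non-attached)))))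
            (≤-trans (+-monoˡ-≤ _ (*-monoʳ-≤ 2 (<⇒≤ L<))) enough)))
        where
        heads : ∀ {P : V → Set} Ps → All P (verts Ps) → All P (map proj₁ Ps)
        heads []             _        = []
        heads ((t , Q) ∷ Ps) (p ∷ ps) = p ∷ heads Ps (All.++⁻ʳ Q ps)

-- Embeddings of graphs and their decidability.

open Graph

lookup-injective : ∀ {A : Set} {xs : List A} → Unique xs → Injective _≡_ _≡_ (lookup xs)
lookup-injective {xs = x ∷ xs} _          {zero}  {zero}  _  = refl
lookup-injective {xs = x ∷ xs} (x∉ ∷ _)   {zero}  {suc j} eq = contradiction eq (All.lookup x∉ (∈.∈-lookup j))
lookup-injective {xs = x ∷ xs} (x∉ ∷ _)   {suc i} {zero}  eq = contradiction (sym eq) (All.lookup x∉ (∈.∈-lookup i))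
lookup-injective {xs = x ∷ xs} (_ ∷ uniq) {suc i} {suc j} eq = cong suc (lookup-injective uniq eq)

lookup-pair : ∀ {A : Set} {R : A → A → Set} → (∀ {x y} → R x y → R y x) → ∀ {xs} → AllPairs R xs →
  ∀ {i j} → i ≢ j → R (lookup xs i) (lookup xs j)
lookup-pair R-sym (_ ∷ _)  {zero}  {zero}  i≢j = contradiction refl i≢j
lookup-pair R-sym (r ∷ _)  {zero}  {suc j} i≢j = All.lookup r (∈.∈-lookup j)
lookup-pair R-sym (r ∷ _)  {suc i} {zero}  i≢j = R-sym (All.lookup r (∈.∈-lookup i))
lookup-pair R-sym (_ ∷ rs) {suc i} {suc j} i≢j = lookup-pair R-sym rs (i≢j ∘ cong suc)

⊑-trans : ∀ G K L → G ⊑ K → K ⊑ L → G ⊑ L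
⊑-trans G K L (f , f-inj , f-adj) (g , g-inj , g-adj) = g ∘ f , f-inj ∘ g-inj , g-adj ∘ f-adj

clique-⊑ : ∀ G K xs → order G ≤ length xs → AllPairs (Adj K) xs → G ⊑ K
clique-⊑ G K xs le cl = f , inj , λ {u} {v} uv → pair (λ e → Adj-irrefl G e uv)
  where
  f : Vertex G → Vertex K
  f u = lookup xs (inject≤ u le)
  pair : ∀ {u v} → u ≢ v → Adj K (f u) (f v)
  pair u≢v = lookup-pair (Adj-sym K) cl (u≢v ∘ Fin.inject≤-injective le le _ _)
  inj : Injective _≡_ _≡_ f
  inj {u} {v} eq with u Fin.≟ v
  ... | yes u≡v = u≡v
  ... | no  u≢v = contradiction (pair u≢v) (Adj-irrefl K eq)

-- Functions between finite sets are coded by numbers. Decoding returns a function that agrees with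
-- the original pointwise, so `P` has to respect pointwise equality.
anyFunction? : ∀ {m n} {P : (Fin m → Fin n) → Set} → (∀ {f g} → (∀ i → f i ≡ g i) → P f → P g) →
  Decidable P → Dec (∃ P)
anyFunction? resp P? = map′ (λ (i , p) → finToFun i , p)
  (λ (f , p) → funToFin f , resp (λ i → sym (Fin.finToFun-funToFin f i)) p)
  (Fin.any? (λ i → P? (finToFun i)))

_⊑?_ : ∀ G K → Dec (G ⊑ K)
G ⊑? K = anyFunction?
  (λ {f} {g} eq (f-inj , f-adj) →
    (λ {x} {y} e → f-inj (trans (eq x) (trans e (sym (eq y))))) ,
    (λ {x} {y} a → subst₂ (Adj K) (eq x) (eq y) (f-adj a)))
  (λ f → map′ (λ p {x} {y} → p x y) (λ p x y → p)
           (Fin.all? λ x → Fin.all? λ y → (f x Fin.≟ f y) →-dec (x Fin.≟ y))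
         ×-dec
         map′ (λ p {x} {y} → p x y) (λ p x y → p)
           (Fin.all? λ x → Fin.all? λ y → Adj? G x y →-dec Adj? K (f x) (f y)))

-- Independent sets and their deletion.

independent? : ∀ G → Decidable (Independent G)
independent? G S = map′ (λ p {x} {y} → p x y) (λ p x y → p)
  (Fin.all? λ x → Fin.all? λ y → (x Subset.∈? S) →-dec ((y Subset.∈? S) →-dec ¬? (Adj? G x y)))

-- Passing to a strictly larger independent set lowers the number of vertices outside, so this ends
-- with a maximal one.
maximal-⊇ : ∀ G S → Independent G S → ∃ λ T → MaximalIndependent G T × S ⊆ₛ T
maximal-⊇ G S ind = go S ind (<-wellFounded _)
  where
  go : ∀ S → Independent G S → Acc _<_ (order G ∸ ∣ S ∣) → ∃ λ T → MaximalIndependent G T × S ⊆ₛ T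
  go S ind (acc rec) with Subset.anySubset? (λ T → independent? G T ×-dec (S Subset.⊂? T))
  ... | yes (T , T-ind , S⊂T) =
    let T′ , max , T⊆T′ = go T T-ind (rec (∸-monoʳ-< (Subset.p⊂q⇒∣p∣<∣q∣ S⊂T) (Subset.∣p∣≤n T)))
    in T′ , max , T⊆T′ ∘ proj₁ S⊂T
  ... | no ∄T = S , (ind , λ {T} T-ind S⊆T {x} x∈T → maximal T-ind S⊆T x∈T) , id
    where
    maximal : ∀ {T x} → Independent G T → S ⊆ₛ T → x ∈ₛ T → x ∈ₛ S
    maximal {T} {x} T-ind S⊆T x∈T with x Subset.∈? S
    ... | yes x∈S = x∈S
    ... | no  x∉S = ⊥-elim (∄T (T , T-ind , S⊆T , x , x∈T , x∉S))

module _ {n : ℕ} (S : Subset n) where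

  remaining : List (Fin n)
  remaining = filter (λ v → ¬? (v Subset.∈? S)) (allFin n)

  remaining-unique : Unique remaining
  remaining-unique = Unique.filter⁺ _ (Unique.allFin⁺ n)

  remaining-∉ : ∀ i → lookup remaining i ∉ₛ S
  remaining-∉ i = proj₂ (∈.∈-filter⁻ (λ v → ¬? (v Subset.∈? S)) {xs = allFin n} (∈.∈-lookup i))

  remaining-index : ∀ {v} → v ∉ₛ S → ∃ λ i → lookup remaining i ≡ v
  remaining-index {v} v∉S = Any.index v∈ , sym (Any.lookup-index v∈)
    where
    v∈ : v ∈ remaining
    v∈ = ∈.∈-filter⁺ (λ v → ¬? (v Subset.∈? S)) (∈.∈-allFin v) v∉S

-- Allows an embedding of `G ─ S` to be given on the vertices outside `S` instead of on positions in
-- a list.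
─-⊑ : ∀ G K S (f : ∀ v → v ∉ₛ S → Vertex K) →
  (∀ {u v} p q → f u p ≡ f v q → u ≡ v) → (∀ {u v} p q → Adj G u v → Adj K (f u p) (f v q)) → (G ─ S) ⊑ K
─-⊑ G K S f f-inj f-adj = (λ i → f _ (remaining-∉ S i)) ,
  (λ e → lookup-injective (remaining-unique S) (f-inj _ _ e)) , f-adj _ _

─-antitone : ∀ G {S T} → S ⊆ₛ T → (G ─ T) ⊑ (G ─ S)
─-antitone G {S} {T} S⊆T = ─-⊑ G (G ─ S) T (λ v v∉T → proj₁ (index v∉T))
  (λ p q e → trans (sym (proj₂ (index p))) (trans (cong (lookup (remaining S)) e) (proj₂ (index q))))
  (λ p q → subst₂ (Adj G) (sym (proj₂ (index p))) (sym (proj₂ (index q))))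
  where
  index : ∀ {v} → v ∉ₛ T → ∃ λ i → lookup (remaining S) i ≡ v
  index v∉T = remaining-index S (v∉T ∘ S⊆T)

-- Deleting a smaller independent set leaves a larger graph, so the maximality in
-- the definition of 𝒟 does not affect containment of a member.
Deleted : Graph → Graph → Set
Deleted G K = ∃ λ S → Independent G S × (G ─ S) ⊑ K

Deleted⇒𝒟 : ∀ G K → Deleted G K → ∃[ D ] 𝒟 G D × D ⊑ K
Deleted⇒𝒟 G K (S , ind , G─S⊑K) with T , max , S⊆T ← maximal-⊇ G S ind =
  G ─ T , delete max , ⊑-trans (G ─ T) (G ─ S) K (─-antitone G S⊆T) G─S⊑K

𝒟⇒Deleted : ∀ G K → (∃[ D ] 𝒟 G D × D ⊑ K) → Deleted G K
𝒟⇒Deleted G K (_ , delete {S} (ind , _) , D⊑K) = S , ind , D⊑K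

deleted? : ∀ G K → Dec (Deleted G K)
deleted? G K = Subset.anySubset? λ S → independent? G S ×-dec ((G ─ S) ⊑? K)

-- The Ramsey number of `𝒟 G` against `H`, by exhaustive search.

open Colouring

module _ (G H : Graph) where

  -- What `Arrows` asks of a single colouring, with membership in `𝒟 G` replaced by the decidable
  -- `Deleted`.
  Good : ∀ {N} → Colouring N → Set
  Good χ = Deleted G (colourClass χ first) ⊎ H ⊑ colourClass χ second

  good? : ∀ {N} → Decidable (Good {N})
  good? χ = deleted? G (colourClass χ first) ⊎-dec (H ⊑? colourClass χ second)

  Good-resp : ∀ {N} {χ ψ : Colouring N} → (∀ u v → colour χ u v ≡ colour ψ u v) → Good χ → Good ψ
  Good-resp {N} {χ} {ψ} eq = Sum.map
      (λ (S , ind , le) → S , ind , ⊑-trans (G ─ S) (colourClass χ first) (colourClass ψ first) le (class first))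
      (λ le → ⊑-trans H (colourClass χ second) (colourClass ψ second) le (class second))
    where
    class : ∀ c → colourClass χ c ⊑ colourClass ψ c
    class c = id , id , λ {u} {v} (u≢v , p) → u≢v , trans (sym (eq u v)) p

  private
    -- Combines the bits stored for the two orders of a pair, so that every bit function decodes to
    -- a symmetric colouring.
    pick : Fin 2 → Fin 2 → Colour
    pick zero zero = first
    pick _    _    = second

    pick-sym : ∀ i j → pick i j ≡ pick j i
    pick-sym zero       zero       = refl
    pick-sym zero       (suc zero) = refl
    pick-sym (suc zero) zero       = refl
    pick-sym (suc zero) (suc zero) = refl

    decode : ∀ {N} → (Fin (N * N) → Fin 2) → Colouring N
    decode f = record
      { colour     = λ u v → pick (f (combine u v)) (f (combine v u))
      ; colour-sym = λ u v → pick-sym (f (combine u v)) (f (combine v u))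
      }

    bit : Colour → Fin 2
    bit first  = zero
    bit second = suc zero

    pick-bit : ∀ c → pick (bit c) (bit c) ≡ c
    pick-bit first  = refl
    pick-bit second = refl

    encode : ∀ {N} → Colouring N → Fin (N * N) → Fin 2
    encode {N} χ x = bit (uncurry (colour χ) (remQuot N x))

    encode-combine : ∀ {N} (χ : Colouring N) u v → encode χ (combine u v) ≡ bit (colour χ u v)
    encode-combine χ u v = cong (bit ∘ uncurry (colour χ)) (Fin.remQuot-combine u v)

    code : ∀ {N} → Colouring N → Fin (2 ^ (N * N))
    code {N} χ = funToFin {N * N} {2} (encode χ)

    decode-code : ∀ {N} (χ : Colouring N) u v → colour (decode (finToFun (code χ))) u v ≡ colour χ u v
    decode-code χ u v = trans (cong₂ pick (at u v) (trans (at v u) (cong bit (colour-sym χ v u)))) (pick-bit _)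
      where
      at : ∀ u v → finToFun (code χ) (combine u v) ≡ bit (colour χ u v)
      at u v = trans (Fin.finToFun-funToFin (encode χ) (combine u v)) (encode-combine χ u v)

  -- Every colouring agrees pointwise with the decoding of one of finitely many codes. A failure
  -- comes with an explicit bad colouring, which the lower bound uses.
  allGood? : ∀ N → (∀ (χ : Colouring N) → Good χ) ⊎ ∃ λ (χ : Colouring N) → ¬ Good χ
  allGood? N with Fin.any? (λ i → ¬? (good? (decode {N} (finToFun i))))
  ... | yes (i , bad) = inj₂ (decode (finToFun i) , bad)
  ... | no  none      = inj₁ λ χ → Good-resp {χ = decode (finToFun (code χ))} {χ} (decode-code χ)
    (decidable-stable (good? (decode (finToFun (code χ)))) (λ bad → none (code χ , bad)))

  allGood⇒Arrows : ∀ {N} → (∀ (χ : Colouring N) → Good χ) → Arrows N (𝒟 G) ｛ H ｝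
  allGood⇒Arrows good χ = Sum.map (Deleted⇒𝒟 G (colourClass χ first)) (λ le → H , refl , le) (good χ)

  Arrows⇒allGood : ∀ {N} → Arrows N (𝒟 G) ｛ H ｝ → ∀ (χ : Colouring N) → Good χ
  Arrows⇒allGood arr χ = Sum.map (𝒟⇒Deleted G (colourClass χ first)) (λ { (_ , refl , le) → le }) (arr χ)

least : ∀ {P : ℕ → Set} (Q : ℕ → Set) → (∀ n → P n ⊎ Q n) → (∀ {n} → Q n → ¬ P n) →
  ∀ n → P n → ∃ λ r → P r × (∀ m → P m → r ≤ m)
least Q dec Q⇒¬P zero    Pn = 0 , Pn , λ _ _ → z≤n
least {P} Q dec Q⇒¬P (suc n) Pn with dec 0
... | inj₁ P0 = 0 , P0 , λ _ _ → z≤n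
... | inj₂ Q0 with r , Pr , min ← least (Q ∘ suc) (dec ∘ suc) Q⇒¬P n Pn =
  suc r , Pr , λ { zero P0 → contradiction P0 (Q⇒¬P Q0) ; (suc m) Pm → s≤s (min m Pm) }

module _ (G H : Graph) where

  -- Bounds the search in `ramseyNumber`. The empty set is independent, so a first-coloured clique
  -- with as many vertices as `G` is enough.
  ramsey-good : ∀ (χ : Colouring (2 ^ (order G + order H))) → Good G H χ
  ramsey-good χ with Ramsey.ramsey (colour χ) (order G) (order H) (allFin _)
                       (≤-reflexive (sym (List.length-tabulate id)))
  ... | inj₁ (ys , zs , p , ∣ys∣ , cl) = inj₁ (∅ , (λ u∈∅ → contradiction u∈∅ Subset.∉⊥) ,
    ⊑-trans (G ─ ∅) G (colourClass χ first) (─-⊑ G G ∅ (λ v _ → v) (λ _ _ → id) (λ _ _ → id))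
      (clique-⊑ G (colourClass χ first) ys (≤-reflexive (sym ∣ys∣))
        (AllPairs.zip (proj₁ (Unique-resp-Part ys p (Unique.allFin⁺ _)) , cl))))
  ... | inj₂ (ys , zs , p , ∣ys∣ , cl) = inj₂
      (clique-⊑ H (colourClass χ second) ys (≤-reflexive (sym ∣ys∣))
        (AllPairs.zip (proj₁ (Unique-resp-Part ys p (Unique.allFin⁺ _)) , cl)))

  Minimal : ℕ → Set
  Minimal r = (∀ (χ : Colouring r) → Good G H χ) × (∀ m → (∀ (χ : Colouring m) → Good G H χ) → r ≤ m)

  ramseyNumber : ∃ Minimal
  ramseyNumber = least (λ N → ∃ λ (χ : Colouring N) → ¬ Good G H χ) (allGood? G H)
    (λ (χ , bad) good → bad (good χ)) _ ramsey-good

  Minimal⇒IsRamsey : ∀ {r} → Minimal r → IsRamsey (𝒟 G) ｛ H ｝ r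
  Minimal⇒IsRamsey (good , min) = allGood⇒Arrows G H good , λ m arr → min m (Arrows⇒allGood G H arr)

-- The lower bound: joining a clique to an extremal colouring.

module _ (a : ℕ) {b : ℕ} (χ : Colouring b) where

  private
    mix : Fin a ⊎ Fin b → Fin a ⊎ Fin b → Colour
    mix (inj₁ _) (inj₁ _) = second
    mix (inj₁ _) (inj₂ _) = first
    mix (inj₂ _) (inj₁ _) = first
    mix (inj₂ i) (inj₂ j) = colour χ i j

    mix-sym : ∀ x y → mix x y ≡ mix y x
    mix-sym (inj₁ _) (inj₁ _) = refl
    mix-sym (inj₁ _) (inj₂ _) = refl
    mix-sym (inj₂ _) (inj₁ _) = refl
    mix-sym (inj₂ i) (inj₂ j) = colour-sym χ i j

  joined : Colouring (a + b)
  joined = record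
    { colour     = λ u v → mix (splitAt a u) (splitAt a v)
    ; colour-sym = λ u v → mix-sym (splitAt a u) (splitAt a v)
    }

  private
    splitAt-inj : ∀ {u v : Fin (a + b)} → splitAt a u ≡ splitAt a v → u ≡ v
    splitAt-inj {u} {v} e = trans (sym (Fin.join-splitAt a b u)) (trans (cong (join a b) e) (Fin.join-splitAt a b v))

    right-edge : ∀ {u v i j c} → splitAt a u ≡ inj₂ i → splitAt a v ≡ inj₂ j →
      Adj (colourClass joined c) u v → Adj (colourClass χ c) i j
    right-edge {u} {v} {i} {j} eu ev (u≢v , p) =
      (λ i≡j → u≢v (splitAt-inj (trans eu (trans (cong inj₂ i≡j) (sym ev))))) ,
      trans (sym (cong₂ mix eu ev)) p

    isLeft : Fin a ⊎ Fin b → Bool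
    isLeft (inj₁ _) = true
    isLeft (inj₂ _) = false

  -- Vertices of `G` placed in the clique are joined in the second colour only, so they form an
  -- independent set; its deletion leaves a graph inside `χ`.
  joined-first : ∀ G → G ⊑ colourClass joined first → Deleted G (colourClass χ first)
  joined-first G (f , f-inj , f-adj) = S , independent ,
    ─-⊑ G (colourClass χ first) S (λ v v∉S → proj₁ (right v v∉S))
      (λ {u} {v} p q e → f-inj (splitAt-inj (trans (proj₂ (right u p)) (trans (cong inj₂ e) (sym (proj₂ (right v q)))))))
      (λ {u} {v} p q uv → right-edge {c = first} (proj₂ (right u p)) (proj₂ (right v q)) (f-adj uv))
    where
    S : Subset (order G)
    S = Vec.tabulate (isLeft ∘ splitAt a ∘ f)
    right : ∀ v → v ∉ₛ S → ∃ λ i → splitAt a (f v) ≡ inj₂ i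
    right v v∉S with splitAt a (f v) in eq
    ... | inj₁ i = contradiction (Vec.lookup⇒[]= v S (trans (Vec.lookup∘tabulate _ v) (cong isLeft eq))) v∉S
    ... | inj₂ i = i , refl
    left : ∀ {v} → v ∈ₛ S → isLeft (splitAt a (f v)) ≡ true
    left {v} v∈S = trans (sym (Vec.lookup∘tabulate _ v)) (Vec.[]=⇒lookup v∈S)
    mix-left : ∀ x y → isLeft x ≡ true → isLeft y ≡ true → mix x y ≡ second
    mix-left (inj₁ _) (inj₁ _) _ _ = refl
    independent : Independent G S
    independent u∈S v∈S uv =
      case trans (sym (proj₂ (f-adj uv))) (mix-left _ _ (left u∈S) (left v∈S)) of λ ()

  -- The `a` clique vertices cannot hold all of `n · H`, so some copy of `H` has a vertex on the
  -- other side. Second-coloured edges never cross, so by connectedness the whole copy lies there.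
  joined-second : ∀ H n → Connected H → a < n * order H → (n · H) ⊑ colourClass joined second →
    H ⊑ colourClass χ second
  joined-second H n (h>0 , walk) a< (f , f-inj , f-adj) with Fin.all? (λ x → isLeft (splitAt a (f x)) ≟ᵇ true)
  ... | yes lefts = contradiction (Fin.injective⇒≤ inj) (<⇒≱ a<)
    where
    left : ∀ s → isLeft s ≡ true → ∃ λ i → s ≡ inj₁ i
    left (inj₁ i) _ = i , refl
    inj : Injective _≡_ _≡_ (λ x → proj₁ (left (splitAt a (f x)) (lefts x)))
    inj {x} {y} e = f-inj (splitAt-inj (trans (proj₂ (left _ (lefts x)))
      (trans (cong inj₁ e) (sym (proj₂ (left _ (lefts y)))))))
  ... | no ¬lefts =
    (λ u → proj₁ (right u)) ,
    (λ {u} {v} e → proj₂ (Fin.combine-injective i u i v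
      (f-inj (splitAt-inj (trans (proj₂ (right u)) (trans (cong inj₂ e) (sym (proj₂ (right v))))))))) ,
    λ {u} {v} uv → right-edge {c = second} (proj₂ (right u)) (proj₂ (right v)) (edge uv)
    where
    x = proj₁ (Fin.¬∀⟶∃¬ (n * order H) _ (λ x → isLeft (splitAt a (f x)) ≟ᵇ true) ¬lefts)
    x-right : isLeft (splitAt a (f x)) ≢ true
    x-right = proj₂ (Fin.¬∀⟶∃¬ (n * order H) _ (λ x → isLeft (splitAt a (f x)) ≟ᵇ true) ¬lefts)
    i = proj₁ (remQuot {n} (order H) x)
    v₀ = proj₂ (remQuot {n} (order H) x)
    edge : ∀ {u v} → Adj H u v → Adj (colourClass joined second) (f (combine i u)) (f (combine i v))
    edge {u} {v} uv = f-adj (subst₂ (λ p q → proj₁ p ≡ proj₁ q × Adj H (proj₂ p) (proj₂ q))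
      (sym (Fin.remQuot-combine i u)) (sym (Fin.remQuot-combine i v)) (refl , uv))
    mix-second : ∀ x y → mix x y ≡ second → isLeft y ≡ true → isLeft x ≡ true
    mix-second (inj₁ _) _        _  _  = refl
    mix-second (inj₂ _) (inj₁ _) () _
    spread : ∀ {u v} → Star (Adj H) u v → isLeft (splitAt a (f (combine i v))) ≡ true → isLeft (splitAt a (f (combine i u))) ≡ true
    spread Star.ε        e = e
    spread (uw Star.◅ w) e = mix-second _ _ (proj₂ (edge uw)) (spread w e)
    right : ∀ u → ∃ λ j → splitAt a (f (combine i u)) ≡ inj₂ j
    right u with splitAt a (f (combine i u)) in eq
    ... | inj₂ j = j , refl
    ... | inj₁ _ = contradiction
      (subst (λ y → isLeft (splitAt a (f y)) ≡ true) (Fin.combine-remQuot {n} (order H) x)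
        (spread (walk v₀ u) (cong isLeft eq))) x-right

restrict : ∀ {M N} → M ≤ N → Colouring N → Colouring M
restrict M≤N χ = record
  { colour     = λ u v → colour χ (inject≤ u M≤N) (inject≤ v M≤N)
  ; colour-sym = λ u v → colour-sym χ (inject≤ u M≤N) (inject≤ v M≤N)
  }

restrict-⊑ : ∀ G {M N} (M≤N : M ≤ N) (χ : Colouring N) c →
  G ⊑ colourClass (restrict M≤N χ) c → G ⊑ colourClass χ c
restrict-⊑ G M≤N χ c le = ⊑-trans G (colourClass (restrict M≤N χ) c) (colourClass χ c) le
  ((λ u → inject≤ u M≤N) , (λ {u} {v} → Fin.inject≤-injective M≤N M≤N u v) ,
   λ {u} {v} (u≢v , p) → (u≢v ∘ Fin.inject≤-injective M≤N M≤N u v) , p)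

-- By minimality of `suc r` some colouring on `r` vertices is bad. Joined to a clique on
-- `n * order H - 1` vertices it refutes the arrow, and by restriction also for every smaller number
-- of vertices.
lowerBound : ∀ G H n r → Connected H → n * order H > 0 → Minimal G H (suc r) →
  ∀ M → Arrows M ｛ G ｝ ｛ n · H ｝ → n * order H + r ≤ M
lowerBound G H n r conn nh>0 (_ , min) M arr with n * order H + r ≤? M
... | yes le = le
... | no  ≰M with allGood? G H r
...   | inj₁ good = contradiction (min r good) (<⇒≱ (n<1+n r))
...   | inj₂ (χ , bad) = contradiction
  (Sum.map (λ { (_ , refl , le) → joined-first a χ G (restrict-⊑ G M≤ (joined a χ) first le) })
           (λ { (_ , refl , le) → joined-second a χ H n conn (≤-reflexive suc-a) (restrict-⊑ (n · H) M≤ (joined a χ) second le) })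
           (arr (restrict M≤ (joined a χ))))
  bad
  where
  a : ℕ
  a = pred (n * order H)
  suc-a : suc a ≡ n * order H
  suc-a = suc-pred (n * order H) {{>-nonZero nh>0}}
  M≤ : M ≤ a + r
  M≤ = ≤-pred (subst (λ l → suc M ≤ l + r) (sym suc-a) (≰⇒> ≰M))

-- Numerical estimates behind the constant 17.

abstract

  -- With X = 2 ^ k all quantities are bounded by powers of X.
  sizes : ∀ {k s g u n N} → s < k → g ≤ k → 2 ^ (17 * k) ≤ n → n ≤ N → N ≤ 64 ^ k * u →
    let M = 2 ^ (k + 2 * k) in
    4 * suc s * (8 * M + 4 * suc s) + 2 * M ≤ u × 2 * (g + k * (M + M * s)) ≤ u
  sizes {k} {s} {g} {u} {n} {N} s<k g≤k n≥ N≥ N≤ =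
      (begin
        4 * suc s * (8 * M + 4 * suc s) + 2 * M    ≡⟨ cong (λ M → 4 * suc s * (8 * M + 4 * suc s) + 2 * M) M≡ ⟩
        4 * suc s * (8 * X³ + 4 * suc s) + 2 * X³  ≤⟨ +-monoˡ-≤ (2 * X³) (*-mono-≤ (*-monoʳ-≤ 4 s<X) (+-monoʳ-≤ (8 * X³) (*-monoʳ-≤ 4 s<X³))) ⟩
        4 * X * (8 * X³ + 4 * X³) + 2 * X³         ≤⟨ +-monoʳ-≤ (4 * X * (8 * X³ + 4 * X³)) (*-monoʳ-≤ 2 (m≤n*m X³ X)) ⟩
        4 * X * (8 * X³ + 4 * X³) + 2 * (X * X³)   ≡⟨ lemma₁ X X³ ⟩
        50 * (X * X³)                              ≤⟨ *-monoˡ-≤ (X * X³) (m≤m+n 50 14) ⟩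
        64 * (X * X³)                              ≤⟨ *-monoˡ-≤ (X * X³) 64≤ ⟩
        X ^ 6 * (X * X³)                           ≡⟨ ^-distribˡ-+-* X 6 4 ⟨
        X ^ 10                                     ≤⟨ m≤n*m (X ^ 10) X ⟩
        X ^ 11                                     ≤⟨ X¹¹≤u ⟩
        u                                          ∎) ,
      (begin
        2 * (g + k * (M + M * s))                  ≡⟨ cong (λ M → 2 * (g + k * (M + M * s))) M≡ ⟩
        2 * (g + k * (X³ + X³ * s))                ≡⟨ cong (λ m → 2 * (g + k * m)) (*-suc X³ s) ⟨
        2 * (g + k * (X³ * suc s))                 ≤⟨ *-monoʳ-≤ 2 (+-mono-≤ (≤-trans g≤k k≤X) (*-mono-≤ k≤X (*-monoʳ-≤ X³ s<X))) ⟩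
        2 * (X + X * (X³ * X))                     ≤⟨ *-monoʳ-≤ 2 (+-monoˡ-≤ (X * (X³ * X)) (m≤m*n X (X³ * X) {{m*n≢0 X³ X}})) ⟩
        2 * (X * (X³ * X) + X * (X³ * X))          ≡⟨ lemma₂ X X³ ⟩
        4 * X ^ 5                                  ≤⟨ *-monoˡ-≤ (X ^ 5) (≤-trans (m≤m+n 4 60) 64≤) ⟩
        X ^ 6 * X ^ 5                              ≡⟨ ^-distribˡ-+-* X 6 5 ⟨
        X ^ 11                                     ≤⟨ X¹¹≤u ⟩
        u                                          ∎)
    where
    open ≤-Reasoning
    M X X³ : ℕ
    M = 2 ^ (k + 2 * k)
    X = 2 ^ k
    X³ = X ^ 3
    instance
      X≢0 : NonZero X
      X≢0 = m^n≢0 2 k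
      X³≢0 : NonZero X³
      X³≢0 = m^n≢0 X 3
    n<2^n : ∀ n → n < 2 ^ n
    n<2^n zero    = s≤s z≤n
    n<2^n (suc n) = begin-strict
      suc n          <⟨ s≤s (n<2^n n) ⟩
      suc (2 ^ n)    ≤⟨ +-monoˡ-≤ (2 ^ n) (m^n>0 2 n) ⟩
      2 ^ n + 2 ^ n  ≡⟨ cong (2 ^ n +_) (+-identityʳ (2 ^ n)) ⟨
      2 ^ suc n      ∎
    k≤X : k ≤ X
    k≤X = <⇒≤ (n<2^n k)
    s<X : s < X
    s<X = ≤-trans s<k k≤X
    s<X³ : s < X³
    s<X³ = ≤-trans s<X (≤-trans (≤-reflexive (sym (*-identityʳ X))) (^-monoʳ-≤ X {1} {3} (s≤s z≤n)))
    M≡ : M ≡ X³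
    M≡ = trans (cong (2 ^_) (lemma k)) (sym (^-*-assoc 2 k 3))
      where
      lemma : ∀ k → k + 2 * k ≡ k * 3
      lemma = solve-∀
    64≤ : 64 ≤ X ^ 6
    64≤ = ^-monoˡ-≤ 6 (^-monoʳ-≤ 2 {1} {k} (≤-trans (s≤s z≤n) s<k))
    -- The exponent 17 is 6 + 11: the factor `64 ^ k` is `X ^ 6`, and both required bounds are at
    -- most `X ^ 11`.
    X¹¹≤u : X ^ 11 ≤ u
    X¹¹≤u = *-cancelˡ-≤ (X ^ 6) {{m^n≢0 X 6}} (begin
      X ^ 6 * X ^ 11   ≡⟨ ^-distribˡ-+-* X 6 11 ⟨
      X ^ 17           ≡⟨ ^-*-assoc 2 k 17 ⟩
      2 ^ (k * 17)     ≡⟨ cong (2 ^_) (*-comm k 17) ⟩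
      2 ^ (17 * k)     ≤⟨ n≥ ⟩
      n                ≤⟨ N≥ ⟩
      N                ≤⟨ N≤ ⟩
      64 ^ k * u       ≡⟨ cong (_* u) (trans (^-*-assoc 2 6 k) (trans (cong (2 ^_) (*-comm 6 k)) (sym (^-*-assoc 2 k 6)))) ⟩
      X ^ 6 * u        ∎)
    lemma₁ : ∀ x y → 4 * x * (8 * y + 4 * y) + 2 * (x * y) ≡ 50 * (x * y)
    lemma₁ = solve-∀
    lemma₂ : ∀ x y → 2 * (x * (y * x) + x * (y * x)) ≡ 4 * (x * (x * y))
    lemma₂ = solve-∀

-- Lists without repetitions as injective maps.

unique-⊆ : ∀ {A : Set} {ys xs : List A} → Unique ys → All (_∈ xs) ys → ∃ λ zs → xs ↭ ys ++ zs
unique-⊆ {xs = xs} [] [] = xs , ↭-refl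
unique-⊆ {ys = y ∷ ys} (y∉ ∷ uniq) (y∈ ∷ ys∈) =
  let xs′ , p = ↭-pick y∈
      zs , q  = unique-⊆ uniq (All.zipWith (λ { (y≢ , z∈) → drop-head y≢ (∈-resp-↭ p z∈) }) (y∉ , ys∈))
  in zs , ↭-trans p (prep y q)
  where
  drop-head : ∀ {A : Set} {y z : A} {xs} → y ≢ z → z ∈ y ∷ xs → z ∈ xs
  drop-head y≢z (here z≡y) = contradiction (sym z≡y) y≢z
  drop-head _   (there z∈) = z∈

tabulate-of-length : ∀ {A : Set} {n} (xs : List A) → length xs ≡ n → ∃ λ (f : Fin n → A) → xs ≡ tabulate f
tabulate-of-length xs refl = lookup xs , sym (List.tabulate-lookup xs)

tabulate-pair : ∀ {A : Set} {R : A → A → Set} → (∀ {x y} → R x y → R y x) → ∀ {n} {f : Fin n → A} →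
  AllPairs R (tabulate f) → ∀ {i j} → i ≢ j → R (f i) (f j)
tabulate-pair {R = R} R-sym {suc n} {f} (r ∷ rs) {zero}  {zero}  i≢j = contradiction refl i≢j
tabulate-pair {R = R} R-sym {suc n} {f} (r ∷ rs) {zero}  {suc j} i≢j = All.tabulate⁻ r j
tabulate-pair {R = R} R-sym {suc n} {f} (r ∷ rs) {suc i} {zero}  i≢j = R-sym (All.tabulate⁻ r i)
tabulate-pair {R = R} R-sym {suc n} {f} (r ∷ rs) {suc i} {suc j} i≢j = tabulate-pair R-sym rs (i≢j ∘ cong suc)

unique-tabulate : ∀ {A : Set} {n} {f : Fin n → A} → Unique (tabulate f) → Injective _≡_ _≡_ f
unique-tabulate uniq {i} {j} eq with i Fin.≟ j
... | yes i≡j = i≡j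
... | no  i≢j = contradiction eq (tabulate-pair ≢-sym uniq i≢j)

-- The upper bound.

module Upper (G H : Graph) {N : ℕ} (χ : Colouring N) (s : ℕ) (h≡ : order H ≡ suc s)
  (no-G : ¬ G ⊑ colourClass χ first) where

  private
    V : Set
    V = Fin N

    k : ℕ
    k = order G ⊔ order H

    s<k : s < k
    s<k = ≤-trans (≤-reflexive (sym h≡)) (m≤n⊔m (order G) (order H))

    M : ℕ
    M = 2 ^ (k + 2 * k)

  -- Loops get the second colour, so that a first-coloured clique has no repetitions.
  col : V → V → Colour
  col u v with u Fin.≟ v
  ... | yes _ = second
  ... | no  _ = colour χ u v

  col-diag : ∀ v → col v v ≡ second
  col-diag v with v Fin.≟ v
  ... | yes _  = refl
  ... | no v≢v = contradiction refl v≢v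

  col-≢ : ∀ {u v} → u ≢ v → col u v ≡ colour χ u v
  col-≢ {u} {v} u≢v with u Fin.≟ v
  ... | yes u≡v = contradiction u≡v u≢v
  ... | no  _   = refl

  col-sym : ∀ u v → col u v ≡ col v u
  col-sym u v with u Fin.≟ v
  ... | yes refl = sym (col-diag u)
  ... | no u≢v   = trans (colour-sym χ u v) (sym (col-≢ (≢-sym u≢v)))

  col-first : ∀ {u v} → col u v ≡ first → Adj (colourClass χ first) u v
  col-first {u} {v} eq with u Fin.≟ v | eq
  ... | no u≢v | eq = u≢v , eq

  open Ramsey col using (Clique; side; side-split; sparse)

  -- The list is the image of `f` in vertex order. Injectivity of `f` is obtained in `copies`, from
  -- lists without repetitions.
  Copy : List V → Set
  Copy ys = ∃ λ (f : Vertex H → V) → ys ≡ tabulate f × (∀ {u v} → Adj H u v → col (f u) (f v) ≡ second)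

  clique-copy : ∀ ys → length ys ≡ suc s → Clique second ys → Copy ys
  clique-copy ys ∣ys∣ cl with f , refl ← tabulate-of-length ys (trans ∣ys∣ (sym h≡)) =
    f , refl , λ uv → tabulate-pair (λ {u} {v} e → trans (col-sym v u) e) cl (λ u≡v → Adj-irrefl H u≡v uv)

  no-first : ∀ ys → length ys ≡ k → ¬ Clique first ys
  no-first ys ∣ys∣ cl = no-G (clique-⊑ G (colourClass χ first) ys
    (≤-trans (m≤m⊔n (order G) (order H)) (≤-reflexive (sym ∣ys∣))) (AllPairs.map col-first cl))

  open Tiling col col-sym k s M s<k ≤-refl no-first Copy clique-copy

  -- Absence of repetitions makes the copies injective and pairwise disjoint; the membership
  -- `F i u ∈ xs` is carried along to separate each tile from the later ones.
  copies : ∀ {ℓ xs} → Cov ℓ xs → Unique xs → ∃ λ t → length xs ≤ t * order H + ℓ ×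
    ∃ λ (F : Fin t → Vertex H → V) → (∀ i u → F i u ∈ xs) ×
      (∀ i j {u v} → F i u ≡ F j v → i ≡ j × u ≡ v) × (∀ i {u v} → Adj H u v → col (F i u) (F i v) ≡ second)
  copies (rest le) _ = 0 , le , (λ ()) , (λ ()) , (λ ()) , λ ()
  copies {ℓ} {xs} (tile {zs = zs} p (f , refl , f-adj) cov) uniq =
    let uniq-f , uniq-zs , f≢ = Unique-resp-Part (tabulate f) p uniq
        t , le , F , F∈ , F-inj , F-adj = copies cov uniq-zs
        F′ : Fin (suc t) → Vertex H → V
        F′ = λ { zero → f ; (suc i) → F i }
    in suc t , size {t} le , F′ ,
       (λ { zero    u → ∈-resp-↭ (↭-sym p) (∈.∈-++⁺ˡ (∈.∈-tabulate⁺ u))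
          ; (suc i) u → ∈-resp-↭ (↭-sym p) (∈.∈-++⁺ʳ (tabulate f) (F∈ i u)) }) ,
       (λ { zero zero e → refl , unique-tabulate uniq-f e
          ; zero (suc j) {u} {v} e → contradiction e (All.lookup (All.tabulate⁻ f≢ u) (F∈ j v))
          ; (suc i) zero {u} {v} e → contradiction (sym e) (All.lookup (All.tabulate⁻ f≢ v) (F∈ i u))
          ; (suc i) (suc j) e → let i≡j , u≡v = F-inj i j e in cong suc i≡j , u≡v }) ,
       λ { zero → f-adj ; (suc i) → F-adj i }
    where
    size : ∀ {t} → length zs ≤ t * order H + ℓ → length xs ≤ suc t * order H + ℓ
    size {t} le = ≤-trans (≤-reflexive (trans (↭-length-++ (tabulate f) p) (cong (_+ length zs) (List.length-tabulate f))))
      (≤-trans (+-monoʳ-≤ (order H) le) (≤-reflexive (sym (+-assoc (order H) (t * order H) ℓ))))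

  cov⇒⊑ : ∀ {n r} → N ≡ n * order H + r → Cov (r + s) (allFin N) → (n · H) ⊑ colourClass χ second
  cov⇒⊑ {n} {r} N≡ cov =
    let t , le , F , _ , F-inj , F-adj = copies cov (Unique.allFin⁺ N)
        n≤t = enough {t} (subst (_≤ t * order H + (r + s)) (trans (List.length-tabulate id) N≡) le)
        i : Fin (n * order H) → Fin t
        i x = inject≤ (proj₁ (remQuot {n} (order H) x)) n≤t
        u : Fin (n * order H) → Vertex H
        u x = proj₂ (remQuot {n} (order H) x)
        f-inj : Injective _≡_ _≡_ (λ x → F (i x) (u x))
        f-inj {x} {y} e =
          let ix≡iy , ux≡uy = F-inj (i x) (i y) {u x} {u y} e in
          trans (sym (Fin.combine-remQuot {n} (order H) x)) (trans
            (cong₂ combine (Fin.inject≤-injective n≤t n≤t _ _ ix≡iy) ux≡uy) (Fin.combine-remQuot {n} (order H) y))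
    in (λ x → F (i x) (u x)) , (λ {x} {y} → f-inj {x} {y}) , λ {x} {y} (i≡j , uv) →
      let fx≢fy = λ e → Adj-irrefl H (proj₂ (F-inj (i x) (i y) {u x} {u y} e)) uv in
      fx≢fy , trans (sym (col-≢ fx≢fy))
        (subst (λ j → col (F (i x) (u x)) (F (inject≤ j n≤t) (u y)) ≡ second) i≡j (F-adj (i x) uv))
    where
    -- The `s = |H| - 1` spare vertices cannot make up for a missing copy:
    -- `n * |H| ≤ t * |H| + s < (t + 1) * |H|`.
    enough : ∀ {t} → n * order H + r ≤ t * order H + (r + s) → n ≤ t
    enough {t} le = ≤-pred (*-cancelʳ-< (order H) n (suc t) (≤-<-trans
      (+-cancelʳ-≤ r (n * order H) (t * order H + s) (≤-trans le (≤-reflexive (lemma (t * order H) r s))))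
      (subst (t * order H + s <_) (+-comm (t * order H) (order H)) (+-monoʳ-< (t * order H) (≤-reflexive (sym h≡))))))
      where
      lemma : ∀ a r s → a + (r + s) ≡ (a + s) + r
      lemma = solve-∀

  -- Each vertex of `im` removes its second-coloured neighbours, at most `D`, from `R`; what remains
  -- is joined to all of `im` in the first colour.
  common : ∀ D im R → All (λ v → length (side second v R) ≤ D) im →
    Part (λ C → All (λ x → All (λ v → col v x ≡ first) im) C × length R ≤ length C + length im * D) R
  common D []       R [] = R , [] , ↭-reflexive (sym (List.++-identityʳ R)) , All.universal (λ _ → []) R , m≤m+n _ 0
  common D (v ∷ im) R (v≤ ∷ im≤) =
    let C , zs , p , firsts , R≤ = common D im R im≤ in
    Part-⊆ p (side first v C , side second v C , side-split v C ,
      All.zipWith (λ (q , qs) → q ∷ qs) (All.all-filter (λ w → col v w ≟ᶜ first) C ,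
               proj₁ (All-↭-++ (side first v C) (side-split v C) firsts)) ,
      (begin
        length R                                                   ≤⟨ R≤ ⟩
        length C + length im * D                                   ≡⟨ cong (_+ length im * D) (↭-length-++ (side first v C) (side-split v C)) ⟩
        length (side first v C) + length (side second v C) + length im * D
          ≤⟨ +-monoˡ-≤ (length im * D) (+-monoʳ-≤ (length (side first v C)) (≤-trans
               (count-mono-↭ (λ w → col v w ≟ᶜ second) zs (↭-trans p (++-comm C zs))) v≤)) ⟩
        length (side first v C) + D + length im * D                ≡⟨ +-assoc (length (side first v C)) D (length im * D) ⟩
        length (side first v C) + (D + length im * D)              ∎))
    where open ≤-Reasoning

  sample : ∀ A {r} → r ≤ length A → Colouring r
  sample A r≤ = record
    { colour     = λ i j → col (lookup A (inject≤ i r≤)) (lookup A (inject≤ j r≤))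
    ; colour-sym = λ i j → col-sym (lookup A (inject≤ i r≤)) (lookup A (inject≤ j r≤))
    }

  -- A first-coloured member of 𝒟 G inside A extends to G by common first-coloured neighbours in R.
  no-deleted : ∀ A R Z {U : List V} → Unique (A ++ R ++ Z) → All (λ v → length (side second v R) < M + M * s) A →
    length U ≤ 2 * length R → 2 * (order G + k * (M + M * s)) ≤ length U →
    ∀ {r} (r≤ : r ≤ length A) → ¬ Deleted G (colourClass (sample A r≤) first)
  no-deleted A R Z {U} uniq few U≤ big {r} r≤ (S , ind , e , e-inj , e-adj) =
    no-G (φ , φ-inj , λ {u} {v} → φ-adj {u} {v})
    where
    a : Fin r → V
    a i = lookup A (inject≤ i r≤)
    im : List V
    im = tabulate (a ∘ e)
    found = common (M + M * s) im R (All.tabulate⁺ (λ i → <⇒≤ (All.lookup few (∈.∈-lookup (inject≤ (e i) r≤)))))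
    C Y : List V
    C = proj₁ found
    Y = proj₁ (proj₂ found)
    R↭ : R ↭ C ++ Y
    R↭ = proj₁ (proj₂ (proj₂ found))
    C-first : All (λ x → All (λ v → col v x ≡ first) im) C
    C-first = proj₁ (proj₂ (proj₂ (proj₂ found)))
    im≤k : length im ≤ k
    im≤k = begin
      length im                         ≡⟨ List.length-tabulate (a ∘ e) ⟩
      length (remaining S)              ≤⟨ List.length-filter (λ v → ¬? (v Subset.∈? S)) (allFin (order G)) ⟩
      length (allFin (order G))         ≡⟨ List.length-tabulate id ⟩
      order G                           ≤⟨ m≤m⊔n (order G) (order H) ⟩
      k                                 ∎
      where open ≤-Reasoning
    G≤C : order G ≤ length C
    -- `R` has at least `order G + k * (M + M * s)` vertices, and each of the at most `k` vertices
    -- of `im` excludes at most `M + M * s` of them.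
    G≤C = +-cancelʳ-≤ (k * (M + M * s)) _ _ (≤-trans (*-cancelˡ-≤ 2 (≤-trans big U≤))
      (≤-trans (proj₂ (proj₂ (proj₂ (proj₂ found)))) (+-monoʳ-≤ (length C) (*-monoˡ-≤ (M + M * s) im≤k))))
    uniq-A : Unique A
    uniq-A = proj₁ (AllPairs-++⁻ A uniq)
    uniq-C : Unique C
    uniq-C = proj₁ (Unique-resp-Part C R↭ (proj₁ (AllPairs-++⁻ R (proj₁ (proj₂ (AllPairs-++⁻ A uniq))))))
    c : Vertex G → V
    c u = lookup C (inject≤ u G≤C)
    c-inj : ∀ {u v} → c u ≡ c v → u ≡ v
    c-inj eq = Fin.inject≤-injective G≤C G≤C _ _ (lookup-injective uniq-C eq)
    a-inj : ∀ {i j} → a i ≡ a j → i ≡ j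
    a-inj eq = Fin.inject≤-injective r≤ r≤ _ _ (lookup-injective uniq-A eq)
    a≢c : ∀ i u → a i ≢ c u
    a≢c i u = All.lookup (All.lookup (proj₂ (proj₂ (AllPairs-++⁻ A uniq))) (∈.∈-lookup (inject≤ i r≤)))
      (∈.∈-++⁺ˡ (∈-resp-↭ (↭-sym R↭) (∈.∈-++⁺ˡ {xs = C} (∈.∈-lookup (inject≤ u G≤C)))))
    ac-first : ∀ i u → col (a (e i)) (c u) ≡ first
    ac-first i u = All.tabulate⁻ (All.lookup C-first (∈.∈-lookup (inject≤ u G≤C))) i
    index : ∀ {v} → v ∉ₛ S → ∃ λ i → lookup (remaining S) i ≡ v
    index = remaining-index S
    φ : Vertex G → V
    φ v with v Subset.∈? S
    ... | yes _   = c v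
    ... | no  v∉S = a (e (proj₁ (index v∉S)))
    φ-inj : Injective _≡_ _≡_ φ
    φ-inj {u} {v} eq with u Subset.∈? S | v Subset.∈? S
    ... | yes _   | yes _   = c-inj eq
    ... | yes _   | no  _   = contradiction (sym eq) (a≢c _ u)
    ... | no  _   | yes _   = contradiction eq (a≢c _ v)
    ... | no u∉S  | no v∉S  = trans (sym (proj₂ (index u∉S)))
      (trans (cong (lookup (remaining S)) (e-inj (a-inj eq))) (proj₂ (index v∉S)))
    φ-adj : ∀ {u v} → Adj G u v → Adj (colourClass χ first) (φ u) (φ v)
    φ-adj {u} {v} uv with u Subset.∈? S | v Subset.∈? S
    -- Only `S` is sent into `C`, and `S` is independent, so no edge inside `C` is asked for.
    ... | yes u∈S | yes v∈S = contradiction uv (ind u∈S v∈S)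
    ... | yes _   | no v∉S  = Adj-sym (colourClass χ first) (col-first (ac-first (proj₁ (index v∉S)) u))
    ... | no u∉S  | yes _   = col-first (ac-first (proj₁ (index u∉S)) v)
    ... | no u∉S  | no v∉S  =
      col-first (proj₂ (e-adj (subst₂ (Adj G) (sym (proj₂ (index u∉S))) (sym (proj₂ (index v∉S))) uv)))

  copy-in : ∀ A → Unique A → ∀ {r} (r≤ : r ≤ length A) → H ⊑ colourClass (sample A r≤) second → Part (λ ys → length ys ≡ suc s × Copy ys) A
  copy-in A uniq r≤ (e , e-inj , e-adj) =
    let zs , p = unique-⊆ (Unique.tabulate⁺ {f = f} (λ eq →
                     e-inj (Fin.inject≤-injective r≤ r≤ _ _ (lookup-injective uniq eq))))
                   (All.tabulate⁺ (λ u → ∈.∈-lookup (inject≤ (e u) r≤)))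
    in tabulate f , zs , p , trans (List.length-tabulate f) h≡ ,
       f , refl , λ uv → proj₂ (e-adj uv)
    where
    f : Vertex H → V
    f u = lookup A (inject≤ (e u) r≤)

  upperBound : ∀ {n r} → (∀ (ψ : Colouring (suc r)) → Good G H ψ) → 2 ^ (17 * k) ≤ n → N ≡ n * order H + r →
    (n · H) ⊑ colourClass χ second
  upperBound {n} {r} good n≥ N≡ with sparse col-diag 64 k (allFin N)
  ... | inj₁ (ys , _ , _ , ∣ys∣ , cl) = contradiction cl (no-first ys ∣ys∣)
  -- The allowance `r + s` consists of `r` vertices with few second-coloured neighbours in the
  -- reservoir and `s` left by absorption; `cov⇒⊑` tolerates exactly this.
  ... | inj₂ (U , O , p , N≤ , few) = cov⇒⊑ N≡ (Cov-↭ p (cover Ab ≤-refl copy-outside))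
    where
    n≤N : n ≤ N
    n≤N = ≤-trans (m≤m*n n (order H) {{subst NonZero (sym h≡) _}}) (≤-trans (m≤m+n _ r) (≤-reflexive (sym N≡)))
    bounds = sizes {k} {s} {order G} s<k (m≤m⊔n (order G) (order H)) n≥ n≤N
      (subst (_≤ 64 ^ k * length U) (List.length-tabulate id) N≤)
    Ab : Absorber U
    Ab = absorber U few (proj₁ bounds)
    open Absorber Ab using (R; large)
    -- The first `suc r` vertices of `A` carry a good colouring. Its first-coloured alternative is
    -- excluded by `no-deleted`, so the other one gives a copy.
    copy-outside : ∀ A Z → U ++ O ↭ A ++ R ++ Z → All (λ v → length (side second v R) < M + M * s) A → r < length A →
      Part (λ ys → length ys ≡ suc s × Copy ys) A
    copy-outside A Z q few r< =
      [ (λ del → contradiction del (no-deleted A R Z {U} uniq few large (proj₂ bounds) r<))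
      , copy-in A (proj₁ (AllPairs-++⁻ A uniq)) r< ]′ (good (sample A r<))
      where
      uniq : Unique (A ++ R ++ Z)
      uniq = AllPairs-↭ ≢-sym (↭-trans p q) (Unique.allFin⁺ N)

-- As `G` has an edge, no independent set contains all its vertices. So every `G ─ S` has a vertex,
-- as does `H`, and neither fits into the colouring on no vertices.
positive : ∀ G H → NonEmpty G → order H > 0 → ¬ Minimal G H 0
positive G H (u , v , uv) h>0 (good , _) with good (record { colour = λ () ; colour-sym = λ () })
... | inj₂ (f , _) = Fin.¬Fin0 (f (fromℕ< h>0))
... | inj₁ (S , ind , f , _) with u Subset.∈? S | v Subset.∈? S
...   | no u∉S  | _       = Fin.¬Fin0 (f (proj₁ (remaining-index S u∉S)))
...   | yes _   | no v∉S  = Fin.¬Fin0 (f (proj₁ (remaining-index S v∉S)))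
...   | yes u∈S | yes v∈S = ind u∈S v∈S uv

-- The value of the Ramsey number, from both bounds.

theorem4 : ∃[ C ] C > 0 ×
    ((G H : Graph) → NonEmpty G → Connected H →
    (n : ℕ) → n ≥ 2 ^ (C * (order G ⊔ order H)) →
    ∃[ R ] ∃[ r ] IsRamsey ｛ G ｝ ｛ n · H ｝ R × IsRamsey (𝒟 G) ｛ H ｝ r × R ≡ (n * order H + r) ∸ 1)
theorem4 = 17 , s≤s z≤n , λ G H nonEmpty connected n n≥ → main G H nonEmpty connected n n≥ (ramseyNumber G H)
  where
  main : ∀ G H → NonEmpty G → Connected H → ∀ n → n ≥ 2 ^ (17 * (order G ⊔ order H)) → ∃ (Minimal G H) →
    ∃[ R ] ∃[ r ] IsRamsey ｛ G ｝ ｛ n · H ｝ R × IsRamsey (𝒟 G) ｛ H ｝ r × R ≡ (n * order H + r) ∸ 1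
  main G H nonEmpty (h>0 , _) n n≥ (zero , minimal) = contradiction minimal (positive G H nonEmpty h>0)
  main G H nonEmpty connected@(h>0 , _) n n≥ (suc r , minimal) =
    -- The Ramsey number of `𝒟 G` against `H` is `suc r`, so the claimed value after subtracting 1
    -- is `n * order H + r`.
    n * order H + r , suc r , (arrows , lowerBound G H n r connected nh>0 minimal) ,
    Minimal⇒IsRamsey G H minimal , cong pred (sym (+-suc (n * order H) r))
    where
    nh>0 : n * order H > 0
    nh>0 = *-mono-≤ (≤-trans (m^n>0 2 (17 * (order G ⊔ order H))) n≥) h>0
    arrows : Arrows (n * order H + r) ｛ G ｝ ｛ n · H ｝
    arrows χ with G ⊑? colourClass χ first
    ... | yes le  = inj₁ (G , refl , le)
    ... | no no-G = inj₂ (n · H , refl ,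
      Upper.upperBound G H χ (pred (order H)) (sym (suc-pred (order H) {{>-nonZero h>0}})) no-G (proj₁ minimal) n≥ refl)
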